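{- Let $\mathcal{A}=(U,\mathcal{C})$ be a bouquet of downset alignments with $\ell$ maximal (by inclusion) members (for example, a median set system with $\ell$ maximal members), such that every element of $U$ belongs to some member of $\mathcal{C}$. Then $\mathcal{A}$ is realizable and $\dim_{\mathbb{E}}(\mathcal{A})\leq\min(|U|,\ \ell\cdot\mathrm{VC\text{ - }dim}(\mathcal{A}))$.
   Context: $U$ is a finite set and $\mathcal{C}\subseteq 2^U$. The pair $(U,\mathcal{C})$ is a bouquet of downset alignments if: (C1$'$) $\varnothing\in\mathcal{C}$; (C2) $X\cap Y\in\mathcal{C}$ for all $X,Y\in\mathcal{C}$; (C3$'$) for all $X,Y\in\mathcal{C}$ with $Y\subsetneq X$ there is $e\in X\setminus Y$ with $Y\cup\{e\}\in\mathcal{C}$; (C8) for all $X,Y\in\mathcal{C}$, if there is $Z\in\mathcal{C}$ with $X\cup Y\subseteq Z$, then $X\cup Y\in\mathcal{C}$. A median set system is a pair $(U,\mathcal{C})$ satisfying (C1$'$), (C2), (C6) for any $x\neq y$ in $U$ there is $K\in\mathcal{C}$ with $|\{x,y\}\cap K|=1$, and (C7) if $K_i,M_i\in\mathcal{C}$ ($i=1,2,3$) satisfy $K_i\cup K_j\subseteq M_k$ whenever $\{i,j,k\}=\{1,2,3\}$, then $K_1\cup K_2\cup K_3\in\mathcal{C}$. Median set systems are bouquets of downset alignments. The VC-dimension of $\mathcal{C}$ is the maximum size of $X\subseteq U$ with $\{S\cap X:S\in\mathcal{C}\}=2^X$. A realization of $\mathcal{C}\subseteq 2^U$ in $\mathbb{R}^m$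 consists of oriented affine hyperplanes $(H_e)_{e\in U}$ of $\mathbb{R}^m$, where $H_e=\{x:a_e\cdot x=b_e\}$ with $a_e\neq 0$, $H_e^+=\{x:a_e\cdot x>b_e\}$, $H_e^-=\{x:a_e\cdot x<b_e\}$, and a relatively open convex set $K\subseteq\mathbb{R}^m$ such that $X\subseteq U$ belongs to $\mathcal{C}$ if and only if there is $x\in K$ with $x\in H_e^+$ for all $e\in X$ and $x\in H_e^-$ for all $e\in U\setminus X$. $\mathcal{C}$ is realizable if it has a realization in some $\mathbb{R}^m$, and the Euclidean dimension $\dim_{\mathbb{E}}$ is the smallest such $m$. -}

module Defs where

open import Algebra.Bundles using (RawMonoid)
import Algebra.Definitions.RawMonoid as RawMonoidDefinitions
open import Data.Fin.Base using (Fin; zero; suc)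
open import Data.Fin.Subset using (Subset; ⊥; ⁅_⁆; _∈_; _∉_; _⊆_; _⊂_; _∪_; _∩_; ∣_∣)
open import Data.List.Base using (List; length)
import Data.List.Membership.Propositional as List
open import Data.List.Relation.Unary.Unique.Propositional using (Unique)
open import Data.Nat.Base as ℕ using (ℕ)
import Data.Nat.Properties as ℕₚ
open import Data.Product.Base using (Σ; ∃; ∃-syntax; _×_; _,_)
open import Data.Rational.Base as ℚ using (ℚ; 0ℚ; 1ℚ; ½)
import Data.Rational.Properties as ℚₚ
open import Data.Rational.Solver using (module +-*-Solver)
open import Data.Sum.Base using (_⊎_)
open import Data.Vec.Functional using (Vector)
open import Function.Bundles using (_⇔_)
open import Level using (0ℓ)
open import Relation.Binary.PropositionalEquality
  using (_≡_; _≢_; refl; sym; trans; cong; subst)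
open import Relation.Unary using (Pred)

private
  variable
    n m : ℕ

------------------------------------------------------------------------
-- Real numbers as Cauchy sequences of rationals

IsCauchy : (ℕ → ℚ) → Set
IsCauchy s = ∀ ε → 0ℚ ℚ.< ε →
  ∃[ N ] (∀ i j → N ℕ.≤ i → N ℕ.≤ j → ℚ.∣ s i ℚ.- s j ∣ ℚ.< ε)

record ℝ : Set where
  constructor mkℝ
  field
    seq    : ℕ → ℚ
    cauchy : IsCauchy seq

open ℝ public

-- Opaque: unfolding these proofs inside 0ℝ, _+ℝ_, … is never needed and
-- makes type checking very slow.
opaque
  0<½* : ∀ {ε} → 0ℚ ℚ.< ε → 0ℚ ℚ.< ½ ℚ.* ε
  0<½* {ε} 0<ε = ℚₚ.*-monoʳ-<-pos ½ 0<ε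

  halves : ∀ ε → ½ ℚ.* ε ℚ.+ ½ ℚ.* ε ≡ ε
  halves ε = trans (sym (ℚₚ.*-distribʳ-+ ε ½ ½)) (ℚₚ.*-identityˡ ε)

  self-minus : ∀ p → ℚ.∣ p ℚ.- p ∣ ≡ 0ℚ
  self-minus p = cong ℚ.∣_∣ (ℚₚ.+-inverseʳ p)

  const-cauchy : ∀ q → IsCauchy (λ _ → q)
  const-cauchy q ε 0<ε =
    0 , λ _ _ _ _ → subst (ℚ._< ε) (sym (self-minus q)) 0<ε

  +-cauchy : ∀ s t → IsCauchy s → IsCauchy t → IsCauchy (λ i → s i ℚ.+ t i)
  +-cauchy s t cs ct ε 0<ε
    with cs (½ ℚ.* ε) (0<½* 0<ε) | ct (½ ℚ.* ε) (0<½* 0<ε)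
  ... | M , hs | N , ht = M ℕ.⊔ N , λ i j i≥ j≥ → begin-strict
      ℚ.∣ (s i ℚ.+ t i) ℚ.- (s j ℚ.+ t j) ∣
        ≡⟨ cong ℚ.∣_∣ (regroup (s i) (t i) (s j) (t j)) ⟩
      ℚ.∣ (s i ℚ.- s j) ℚ.+ (t i ℚ.- t j) ∣
        ≤⟨ ℚₚ.∣p+q∣≤∣p∣+∣q∣ (s i ℚ.- s j) (t i ℚ.- t j) ⟩
      ℚ.∣ s i ℚ.- s j ∣ ℚ.+ ℚ.∣ t i ℚ.- t j ∣
        <⟨ ℚₚ.+-mono-< (hs i j (ℕₚ.m⊔n≤o⇒m≤o M N i≥) (ℕₚ.m⊔n≤o⇒m≤o M N j≥))
                       (ht i j (ℕₚ.m⊔n≤o⇒n≤o M N i≥) (ℕₚ.m⊔n≤o⇒n≤o M N j≥)) ⟩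
      ½ ℚ.* ε ℚ.+ ½ ℚ.* ε
        ≡⟨ halves ε ⟩
      ε ∎
    where
    open ℚₚ.≤-Reasoning
    open +-*-Solver
    regroup : ∀ a b c d → (a ℚ.+ b) ℚ.- (c ℚ.+ d) ≡ (a ℚ.- c) ℚ.+ (b ℚ.- d)
    regroup = solve 4 (λ a b c d → (a :+ b) :- (c :+ d) := (a :- c) :+ (b :- d)) refl

  neg-cauchy : ∀ s → IsCauchy s → IsCauchy (λ i → ℚ.- s i)
  neg-cauchy s cs ε 0<ε with cs ε 0<ε
  ... | N , h = N , λ i j i≥ j≥ →
      subst (ℚ._< ε) (sym (trans (cong ℚ.∣_∣ (regroup (s i) (s j)))
                                 (ℚₚ.∣-p∣≡∣p∣ (s i ℚ.- s j))))
            (h i j i≥ j≥)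
    where
    open +-*-Solver
    regroup : ∀ a b → (ℚ.- a) ℚ.- (ℚ.- b) ≡ ℚ.- (a ℚ.- b)
    regroup = solve 2 (λ a b → (:- a) :- (:- b) := :- (a :- b)) refl

  cauchy-bound : ∀ s → IsCauchy s →
    ∃[ B ] (0ℚ ℚ.< B × ∃[ N ] (∀ i → N ℕ.≤ i → ℚ.∣ s i ∣ ℚ.≤ B))
  cauchy-bound s cs with cs 1ℚ (ℚₚ.positive⁻¹ 1ℚ)
  ... | N , h = B , ℚₚ.+-mono-<-≤ (ℚₚ.positive⁻¹ 1ℚ) (ℚₚ.0≤∣p∣ (s N)) , N , bound
    where
    open ℚₚ.≤-Reasoning
    open +-*-Solver
    B : ℚ
    B = 1ℚ ℚ.+ ℚ.∣ s N ∣
    regroup : ∀ a b → a ≡ (a ℚ.- b) ℚ.+ b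
    regroup = solve 2 (λ a b → a := (a :- b) :+ b) refl
    bound : ∀ i → N ℕ.≤ i → ℚ.∣ s i ∣ ℚ.≤ B
    bound i i≥ = begin
      ℚ.∣ s i ∣                       ≡⟨ cong ℚ.∣_∣ (regroup (s i) (s N)) ⟩
      ℚ.∣ (s i ℚ.- s N) ℚ.+ s N ∣     ≤⟨ ℚₚ.∣p+q∣≤∣p∣+∣q∣ (s i ℚ.- s N) (s N) ⟩
      ℚ.∣ s i ℚ.- s N ∣ ℚ.+ ℚ.∣ s N ∣ ≤⟨ ℚₚ.+-monoˡ-≤ ℚ.∣ s N ∣ (ℚₚ.<⇒≤ (h i N i≥ ℕₚ.≤-refl)) ⟩
      B                               ∎

  fraction : ∀ B ε → 0ℚ ℚ.< B → 0ℚ ℚ.< ε → ∃[ δ ] (0ℚ ℚ.< δ × B ℚ.* δ ≡ ε)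
  fraction B ε 0<B 0<ε = δ , 0<δ , Bδ≡ε
    where
    instance
      B⁺ : ℚ.Positive B
      B⁺ = ℚ.positive 0<B
      ε⁺ : ℚ.Positive ε
      ε⁺ = ℚ.positive 0<ε
      B≢0 : ℚ.NonZero B
      B≢0 = ℚₚ.pos⇒nonZero B
      1/B⁺ : ℚ.Positive (ℚ.1/ B)
      1/B⁺ = ℚₚ.1/pos⇒pos B
    δ : ℚ
    δ = (ℚ.1/ B) ℚ.* ε
    0<δ : 0ℚ ℚ.< δ
    0<δ = ℚₚ.positive⁻¹ δ {{ℚₚ.pos*pos⇒pos (ℚ.1/ B) ε}}
    Bδ≡ε : B ℚ.* δ ≡ ε
    Bδ≡ε = trans (sym (ℚₚ.*-assoc B (ℚ.1/ B) ε))
                 (trans (cong (ℚ._* ε) (ℚₚ.*-inverseʳ B)) (ℚₚ.*-identityˡ ε))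

  *-small : ∀ A ρ κ p q → 0ℚ ℚ.< A → ℚ.∣ p ∣ ℚ.≤ A → ℚ.∣ q ∣ ℚ.< ρ →
            A ℚ.* ρ ≡ κ → ℚ.∣ p ℚ.* q ∣ ℚ.< κ
  *-small A ρ κ p q 0<A p≤A q<ρ Aρ = begin-strict
    ℚ.∣ p ℚ.* q ∣       ≡⟨ ℚₚ.∣p*q∣≡∣p∣*∣q∣ p q ⟩
    ℚ.∣ p ∣ ℚ.* ℚ.∣ q ∣ ≤⟨ ℚₚ.*-monoʳ-≤-nonNeg ℚ.∣ q ∣ {{ℚ.nonNegative (ℚₚ.0≤∣p∣ q)}} p≤A ⟩
    A ℚ.* ℚ.∣ q ∣       <⟨ ℚₚ.*-monoʳ-<-pos A {{ℚ.positive 0<A}} q<ρ ⟩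
    A ℚ.* ρ             ≡⟨ Aρ ⟩
    κ                   ∎
    where open ℚₚ.≤-Reasoning

  *-regroup : ∀ a b c d → a ℚ.* b ℚ.- c ℚ.* d ≡ a ℚ.* (b ℚ.- d) ℚ.+ d ℚ.* (a ℚ.- c)
  *-regroup = solve 4 (λ a b c d → a :* b :- c :* d := a :* (b :- d) :+ d :* (a :- c)) refl
    where open +-*-Solver

  *-close : ∀ κ a b c d → ℚ.∣ a ℚ.* (b ℚ.- d) ∣ ℚ.< κ → ℚ.∣ d ℚ.* (a ℚ.- c) ∣ ℚ.< κ →
            ℚ.∣ a ℚ.* b ℚ.- c ℚ.* d ∣ ℚ.< κ ℚ.+ κ
  *-close κ a b c d h₁ h₂ = begin-strict
    ℚ.∣ a ℚ.* b ℚ.- c ℚ.* d ∣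
      ≡⟨ cong ℚ.∣_∣ (*-regroup a b c d) ⟩
    ℚ.∣ a ℚ.* (b ℚ.- d) ℚ.+ d ℚ.* (a ℚ.- c) ∣
      ≤⟨ ℚₚ.∣p+q∣≤∣p∣+∣q∣ (a ℚ.* (b ℚ.- d)) (d ℚ.* (a ℚ.- c)) ⟩
    ℚ.∣ a ℚ.* (b ℚ.- d) ∣ ℚ.+ ℚ.∣ d ℚ.* (a ℚ.- c) ∣
      <⟨ ℚₚ.+-mono-< h₁ h₂ ⟩
    κ ℚ.+ κ ∎
    where open ℚₚ.≤-Reasoning

  *-cauchy : ∀ s t → IsCauchy s → IsCauchy t → IsCauchy (λ i → s i ℚ.* t i)
  *-cauchy s t cs ct ε 0<ε =
    let κ = ½ ℚ.* ε
        B , 0<B , M₁ , s≤B = cauchy-bound s cs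
        C , 0<C , N₁ , t≤C = cauchy-bound t ct
        δ , 0<δ , Bδ = fraction B κ 0<B (0<½* 0<ε)
        η , 0<η , Cη = fraction C κ 0<C (0<½* 0<ε)
        M₂ , hs = cs η 0<η
        N₂ , ht = ct δ 0<δ
        L = M₁ ℕ.⊔ N₁
        R = M₂ ℕ.⊔ N₂
    in L ℕ.⊔ R , λ i j i≥ j≥ →
      let iL = ℕₚ.m⊔n≤o⇒m≤o L R i≥
          iR = ℕₚ.m⊔n≤o⇒n≤o L R i≥
          jL = ℕₚ.m⊔n≤o⇒m≤o L R j≥
          jR = ℕₚ.m⊔n≤o⇒n≤o L R j≥
      in subst (ℚ.∣ s i ℚ.* t i ℚ.- s j ℚ.* t j ∣ ℚ.<_) (halves ε)
           (*-close κ (s i) (t i) (s j) (t j)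
             (*-small B δ κ (s i) (t i ℚ.- t j) 0<B (s≤B i (ℕₚ.m⊔n≤o⇒m≤o M₁ N₁ iL))
               (ht i j (ℕₚ.m⊔n≤o⇒n≤o M₂ N₂ iR) (ℕₚ.m⊔n≤o⇒n≤o M₂ N₂ jR)) Bδ)
             (*-small C η κ (t j) (s i ℚ.- s j) 0<C (t≤C j (ℕₚ.m⊔n≤o⇒n≤o M₁ N₁ jL))
               (hs i j (ℕₚ.m⊔n≤o⇒m≤o M₂ N₂ iR) (ℕₚ.m⊔n≤o⇒m≤o M₂ N₂ jR)) Cη))

infix  4 _≈ℝ_ _<ℝ_ _≤ℝ_
infixl 6 _+ℝ_ _-ℝ_
infixl 7 _*ℝ_
infix  8 -ℝ_

fromℚ : ℚ → ℝ
fromℚ q = mkℝ (λ _ → q) (const-cauchy q)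

0ℝ 1ℝ : ℝ
0ℝ = fromℚ 0ℚ
1ℝ = fromℚ 1ℚ

_+ℝ_ _*ℝ_ : ℝ → ℝ → ℝ
x +ℝ y = mkℝ (λ i → seq x i ℚ.+ seq y i) (+-cauchy (seq x) (seq y) (cauchy x) (cauchy y))
x *ℝ y = mkℝ (λ i → seq x i ℚ.* seq y i) (*-cauchy (seq x) (seq y) (cauchy x) (cauchy y))

-ℝ_ : ℝ → ℝ
-ℝ x = mkℝ (λ i → ℚ.- seq x i) (neg-cauchy (seq x) (cauchy x))

_-ℝ_ : ℝ → ℝ → ℝ
x -ℝ y = x +ℝ (-ℝ y)

record _≈ℝ_ (x y : ℝ) : Set where
  constructor mk≈
  field
    close : ∀ ε → 0ℚ ℚ.< ε →
      ∃[ N ] (∀ i → N ℕ.≤ i → ℚ.∣ seq x i ℚ.- seq y i ∣ ℚ.< ε)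

record _<ℝ_ (x y : ℝ) : Set where
  constructor mk<
  field
    gap        : ℚ
    gap>0      : 0ℚ ℚ.< gap
    eventually : ∃[ N ] (∀ i → N ℕ.≤ i → seq x i ℚ.+ gap ℚ.< seq y i)

record _≤ℝ_ (x y : ℝ) : Set where
  constructor mk≤
  field
    within : ∀ ε → 0ℚ ℚ.< ε →
      ∃[ N ] (∀ i → N ℕ.≤ i → seq x i ℚ.< seq y i ℚ.+ ε)

+ℝ-rawMonoid : RawMonoid 0ℓ 0ℓ
+ℝ-rawMonoid = record { Carrier = ℝ ; _≈_ = _≈ℝ_ ; _∙_ = _+ℝ_ ; ε = 0ℝ }

open RawMonoidDefinitions +ℝ-rawMonoid public using () renaming (sum to ∑ℝ)

------------------------------------------------------------------------
-- Affine and convex geometry in ℝ^m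

ℝ^ : ℕ → Set
ℝ^ m = Vector ℝ m

_≈ᵛ_ : ℝ^ m → ℝ^ m → Set
x ≈ᵛ y = ∀ i → x i ≈ℝ y i

_·_ : ℝ^ m → ℝ^ m → ℝ
a · x = ∑ℝ (λ i → a i *ℝ x i)

-- The positive form of "a is not the zero vector": some coordinate is
-- apart from 0.
NonZeroᵛ : ℝ^ m → Set
NonZeroᵛ a = ∃[ i ] (a i <ℝ 0ℝ ⊎ 0ℝ <ℝ a i)

-- ℝ carries a setoid equality, so a subset of ℝ^m is a predicate that
-- respects it.
Respects≈ : Pred (ℝ^ m) 0ℓ → Set
Respects≈ K = ∀ {x y} → x ≈ᵛ y → K x → K y

Convex : Pred (ℝ^ m) 0ℓ → Set
Convex K = ∀ {x y} → K x → K y →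
  ∀ s t → 0ℝ ≤ℝ s → 0ℝ ≤ℝ t → s +ℝ t ≈ℝ 1ℝ →
  K (λ i → s *ℝ x i +ℝ t *ℝ y i)

AffineHull : Pred (ℝ^ m) 0ℓ → Pred (ℝ^ m) 0ℓ
AffineHull K y =
  ∃[ k ] Σ (Fin k → ℝ^ _) λ p → Σ (Fin k → ℝ) λ c →
    (∀ j → K (p j)) ×
    ∑ℝ c ≈ℝ 1ℝ ×
    y ≈ᵛ (λ i → ∑ℝ (λ j → c j *ℝ p j i))

-- Open in the subspace topology of the affine hull; neighbourhoods are
-- taken in the product topology of ℝ^m, that is, as open boxes.
RelativelyOpen : Pred (ℝ^ m) 0ℓ → Set
RelativelyOpen K = ∀ {x} → K x →
  ∃[ ε ] (0ℝ <ℝ ε ×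
    (∀ {y} → AffineHull K y → (∀ i → x i -ℝ ε <ℝ y i × y i <ℝ x i +ℝ ε) → K y))

------------------------------------------------------------------------
-- Set systems on the ground set U = Fin n

SetSystem : ℕ → Set₁
SetSystem n = Pred (Subset n) 0ℓ

record IsBouquetOfDownsetAlignments (𝒞 : SetSystem n) : Set where
  field
    ∅-member  : 𝒞 ⊥
    ∩-closed  : ∀ X Y → 𝒞 X → 𝒞 Y → 𝒞 (X ∩ Y)
    extension : ∀ X Y → 𝒞 X → 𝒞 Y → Y ⊂ X →
                ∃[ e ] (e ∈ X × e ∉ Y × 𝒞 (Y ∪ ⁅ e ⁆))
    bounded-∪ : ∀ X Y → 𝒞 X → 𝒞 Y →
                (∃[ Z ] (𝒞 Z × (X ∪ Y) ⊆ Z)) → 𝒞 (X ∪ Y)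

record IsMedian (𝒞 : SetSystem n) : Set where
  field
    ∅-member   : 𝒞 ⊥
    ∩-closed   : ∀ X Y → 𝒞 X → 𝒞 Y → 𝒞 (X ∩ Y)
    separation : ∀ x y → x ≢ y →
                 ∃[ K ] (𝒞 K × ∣ (⁅ x ⁆ ∪ ⁅ y ⁆) ∩ K ∣ ≡ 1)
    triple-∪   : ∀ (K M : Fin 3 → Subset n) →
                 (∀ i → 𝒞 (K i)) → (∀ i → 𝒞 (M i)) →
                 (∀ i j k → i ≢ j → j ≢ k → i ≢ k → (K i ∪ K j) ⊆ M k) →
                 𝒞 (K zero ∪ K (suc zero) ∪ K (suc (suc zero)))

Covers : SetSystem n → Set
Covers {n} 𝒞 = (e : Fin n) → ∃[ X ] (𝒞 X × e ∈ X)

IsMaximalMember : SetSystem n → Pred (Subset n) 0ℓ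
IsMaximalMember 𝒞 X = 𝒞 X × (∀ Y → 𝒞 Y → X ⊆ Y → X ≡ Y)

-- The number of maximal members is ℓ.
HasMaximalMembers : SetSystem n → ℕ → Set
HasMaximalMembers {n} 𝒞 ℓ =
  Σ (List (Subset n)) λ Ms →
    Unique Ms × (∀ X → X List.∈ Ms ⇔ IsMaximalMember 𝒞 X) × length Ms ≡ ℓ

-- S ∩ X always lies in 2^X, so only the inclusion of 2^X in the set of
-- traces is required.
Shatters : SetSystem n → Pred (Subset n) 0ℓ
Shatters 𝒞 X = ∀ Y → Y ⊆ X → ∃[ S ] (𝒞 S × S ∩ X ≡ Y)

IsVCDimension : SetSystem n → ℕ → Set
IsVCDimension 𝒞 d =
  (∃[ X ] (Shatters 𝒞 X × ∣ X ∣ ≡ d)) ×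
  (∀ X → Shatters 𝒞 X → ∣ X ∣ ℕ.≤ d)

------------------------------------------------------------------------
-- Realizations

record OrientedHyperplane (m : ℕ) : Set where
  field
    normal         : ℝ^ m
    offset         : ℝ
    normal-nonzero : NonZeroᵛ normal

PositiveSide NegativeSide : OrientedHyperplane m → Pred (ℝ^ m) 0ℓ
PositiveSide H x = OrientedHyperplane.offset H <ℝ (OrientedHyperplane.normal H · x)
NegativeSide H x = (OrientedHyperplane.normal H · x) <ℝ OrientedHyperplane.offset H

record Realization (𝒞 : SetSystem n) (m : ℕ) : Set₁ where
  field
    hyperplane      : Fin n → OrientedHyperplane m
    region          : Pred (ℝ^ m) 0ℓ
    region-respects : Respects≈ region
    region-convex   : Convex region
    region-open     : RelativelyOpen region
    cells           : ∀ X → 𝒞 X ⇔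
      (∃[ x ] (region x ×
               (∀ e → e ∈ X → PositiveSide (hyperplane e) x) ×
               (∀ e → e ∉ X → NegativeSide (hyperplane e) x)))

Realizable : SetSystem n → Set₁
Realizable 𝒞 = ∃[ m ] Realization 𝒞 m

IsEuclideanDimension : SetSystem n → ℕ → Set₁
IsEuclideanDimension 𝒞 m =
  Realization 𝒞 m × (∀ k → Realization 𝒞 k → m ℕ.≤ k)

-- The least m with a realization in ℝ^m cannot be computed constructively,
-- so "dim ≤ N" consists of a realization in some ℝ^m with m ≤ N and the
-- bound for the least such m. Classically each part implies the other
-- when 𝒞 is realizable.
EuclideanDimension≤ : SetSystem n → ℕ → Set₁
EuclideanDimension≤ 𝒞 N =
  (∃[ m ] (m ℕ.≤ N × Realization 𝒞 m)) ×
  (∀ m → IsEuclideanDimension 𝒞 m → m ℕ.≤ N)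

{-# OPTIONS --safe #-}

-- The relation f ≼ e, "every member containing e contains f", is a partial
-- order on U, and 𝒞 consists of the downsets of ≼ that lie inside some member.
-- An antichain inside a member is shattered, so antichains have at most
-- n ⊓ (ℓ * d) elements, and by Dilworth's theorem U is covered by that many
-- chains.  Each chain becomes one coordinate axis, and e becomes the hyperplane
-- z_(c e) = - τ_(rank e), where the thresholds τ tend to 0 superexponentially.
-- The region is cut out by one open half-space per non-member X: this
-- excludes the cell of X but contains a chosen point of every member's cell.

module Submission where

open import Defs
open import Data.Nat.Base using (ℕ; _*_; _⊓_)
open import Data.Product.Base using (_×_)
open import Data.Sum.Base using (_⊎_)
open import Relation.Unary using (Decidable)

open import Data.Fin.Base using (Fin; zero; suc)
import Data.Fin.Properties as Finₚ
open import Data.Fin.Subset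
  using (Subset; inside; outside; ⊤; ⊥; ⁅_⁆; _∈_; _∉_; _⊆_; _∪_; _∩_; _─_; _-_; ∣_∣)
import Data.Fin.Subset.Properties as Subₚ
open import Data.List.Base using (List; []; _∷_; length; map; allFin; filter)
open import Data.List.Extrema.Nat using (max; v≤max⁺; max≤v⁺)
import Data.List.Membership.Propositional as List
import Data.List.Membership.Propositional.Properties as List
import Data.List.Relation.Unary.All as All
open import Data.List.Relation.Unary.Any as Any using (Any; here; there)
open import Data.Nat.Base as ℕ using (zero; suc; z≤n; s≤s; s≤s⁻¹)
open import Data.Nat.Induction using (<-wellFounded)
import Data.Nat.Properties as ℕₚ
open import Data.Product.Base using (Σ; ∃; ∃-syntax; _,_; proj₁; proj₂)
open import Data.Rational.Base as ℚ using (ℚ; 0ℚ; 1ℚ; ½)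
import Data.Rational.Properties as ℚₚ
open import Data.Rational.Solver using (module +-*-Solver)
open import Data.Sum.Base using (inj₁; inj₂; [_,_]′)
import Data.Unit.Base as Unit
open import Data.Vec.Base using ([]; _∷_; here; there; tabulate)
import Data.Vec.Functional as Vector
import Data.Vec.Properties as Vecₚ
open import Function.Base using (_∘_; id; case_of_)
open import Function.Bundles using (Equivalence; mk⇔)
open import Induction.WellFounded using (Acc; acc)
open import Level using (0ℓ)
open import Relation.Binary.Core using (Rel)
open import Relation.Binary.PropositionalEquality
  using (_≡_; _≢_; refl; sym; trans; cong; cong₂; subst; subst₂; isEquivalence)
open import Relation.Binary.Structures using (IsDecPartialOrder)
open import Relation.Nullary
  using (Dec; yes; no; ¬_; does; contradiction; ¬?; _×-dec_; _⊎-dec_; _→-dec_)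
open import Relation.Nullary.Decidable using (decidable-stable; dec-true; from-yes; map′)
open import Relation.Unary using (Pred)

-- Along one axis the positive sides are nested by rank, so the arrangement by itself sees the order
-- only inside single chains. A non-member fails in one of two ways, as a set that is not a downset
-- or as a downset inside no member, and each failure has its own kind of half-space. The scale of
-- the thresholds comes from the first kind. For f ≼ e with e in X and f not in X, let ρ be the
-- level at the rank of e. At members avoiding e, z_e is at most - ρ while z_f has size at most 1,
-- so z_f can carry a coefficient of order ρ. At members through e, the margin z_f + τ_f is only
-- guaranteed to be at least ρ, so the product ρ² has to beat τ_e. Hence τ_e is quadratic in ρ, and
-- this causes the superexponential decay. Ranks are taken in the whole poset, not in a chain, so
-- that the comparison also works when e and f lie on different axes. The factor δ in the thresholds
-- answers the second kind: there one element missing from a member must outweigh up to n present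
-- ones.

private
  variable
    n m : ℕ
    p q r : ℚ

-- Extremal elements and cardinalities of finite sets

module _ {A : Set} (any? : ∀ {P : Pred A 0ℓ} → Decidable P → Dec (∃ P)) where

  opaque
    argmin : (μ : A → ℕ) {P : Pred A 0ℓ} → Decidable P → ∀ {x} → P x →
             ∃[ y ] (P y × (∀ z → P z → μ y ℕ.≤ μ z))
    argmin μ {P} P? {x} = search (<-wellFounded (μ x))
      where
      search : ∀ {x} → Acc ℕ._<_ (μ x) → P x →
               ∃[ y ] (P y × (∀ z → P z → μ y ℕ.≤ μ z))
      search {x} (acc rec) px with any? (λ z → P? z ×-dec (μ z ℕₚ.<? μ x))
      ... | yes (z , pz , z<x) = search (rec z<x) pz
      ... | no ¬smaller = x , px , λ z pz → ℕₚ.≮⇒≥ λ z<x → ¬smaller (z , pz , z<x)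

    argmax : (μ : A → ℕ) (B : ℕ) → (∀ x → μ x ℕ.≤ B) →
             {P : Pred A 0ℓ} → Decidable P → ∀ {x} → P x →
             ∃[ y ] (P y × (∀ z → P z → μ z ℕ.≤ μ y))
    argmax μ B μ≤B P? px with argmin (λ x → B ℕ.∸ μ x) P? px
    ... | y , py , least =
      y , py , λ z pz → ℕₚ.≮⇒≥ λ y<z →
        ℕₚ.<⇒≱ (ℕₚ.∸-monoʳ-< y<z (μ≤B z)) (least z pz)

argmaxᶠ : (μ : Fin n → ℕ) (B : ℕ) → (∀ x → μ x ℕ.≤ B) →
          {P : Pred (Fin n) 0ℓ} → Decidable P → ∀ {x} → P x →
          ∃[ y ] (P y × (∀ z → P z → μ z ℕ.≤ μ y))
argmaxᶠ = argmax Finₚ.any?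

largest : {P : Pred (Subset n) 0ℓ} → Decidable P → ∀ {X} → P X →
          ∃[ Y ] (P Y × (∀ Z → P Z → ∣ Z ∣ ℕ.≤ ∣ Y ∣))
largest {n} = argmax Subₚ.anySubset? ∣_∣ n Subₚ.∣p∣≤n

smallest : {P : Pred (Subset n) 0ℓ} → Decidable P → ∀ {X} → P X →
           ∃[ Y ] (P Y × (∀ Z → P Z → ∣ Y ∣ ℕ.≤ ∣ Z ∣))
smallest = argmin Subₚ.anySubset? ∣_∣

opaque
  ⟦_⟧ : {P : Pred (Fin n) 0ℓ} → Decidable P → Subset n
  ⟦ P? ⟧ = tabulate (does ∘ P?)

  ∈⟦⟧⁺ : {P : Pred (Fin n) 0ℓ} (P? : Decidable P) → ∀ {x} → P x → x ∈ ⟦ P? ⟧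
  ∈⟦⟧⁺ P? {x} px = Vecₚ.lookup⇒[]= x _
    (trans (Vecₚ.lookup∘tabulate _ x) (dec-true (P? x) px))

  ∈⟦⟧⁻ : {P : Pred (Fin n) 0ℓ} (P? : Decidable P) → ∀ {x} → x ∈ ⟦ P? ⟧ → P x
  ∈⟦⟧⁻ P? {x} x∈ with P? x in eq
  ... | yes px = px
  ... | no ¬px = case trans (sym (Vecₚ.[]=⇒lookup x∈))
                            (trans (Vecₚ.lookup∘tabulate (does ∘ P?) x) (cong does eq)) of λ ()

⊆∧∣∣≤⇒≡ : {X Y : Subset n} → X ⊆ Y → ∣ Y ∣ ℕ.≤ ∣ X ∣ → X ≡ Y
⊆∧∣∣≤⇒≡ {X = X} {Y} X⊆Y Y≤X = Subₚ.⊆-antisym X⊆Y λ {x} x∈Y →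
  decidable-stable (x Subₚ.∈? X) λ x∉X →
    ℕₚ.<⇒≱ (Subₚ.p⊂q⇒∣p∣<∣q∣ (X⊆Y , x , x∈Y , x∉X)) Y≤X

x∈p─q⁻ : ∀ (p q : Subset n) {x} → x ∈ p ─ q → x ∈ p × x ∉ q
x∈p─q⁻ p q {x} x∈ = Subₚ.p─q⊆p p q x∈ , λ x∈q → absurd p q x∈ x∈q
  where
  absurd : ∀ {n} (p q : Subset n) {x} → x ∈ p ─ q → x ∉ q
  absurd (_ ∷ p) (outside ∷ q) {suc x} (there x∈) (there x∈q) = absurd p q x∈ x∈q
  absurd (_ ∷ p) (inside  ∷ q) {suc x} (there x∈) (there x∈q) = absurd p q x∈ x∈q

-- Deleting the image of the first element from `B` leaves room for the images of the others. The
-- map takes a membership proof because colours of elements are later extracted from such proofs.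
∣∣-injective : (A : Subset n) (B : Subset m) (f : ∀ {x} → x ∈ A → Fin m) →
               (∀ {x} (p : x ∈ A) → f p ∈ B) →
               (∀ {x y} (p : x ∈ A) (q : y ∈ A) → f p ≡ f q → x ≡ y) →
               ∣ A ∣ ℕ.≤ ∣ B ∣
∣∣-injective []            B f f∈B inj = z≤n
∣∣-injective (outside ∷ A) B f f∈B inj =
  ∣∣-injective A B (f ∘ there) (f∈B ∘ there)
    λ p q eq → Finₚ.suc-injective (inj (there p) (there q) eq)
∣∣-injective (inside ∷ A)  B f f∈B inj = ℕₚ.≤-<-trans
  (∣∣-injective A (B - f here) (f ∘ there)
    (λ p → Subₚ.x∈p∧x≢y⇒x∈p-y (f∈B (there p))
      λ eq → case inj (there p) here eq of λ ())
    λ p q eq → Finₚ.suc-injective (inj (there p) (there q) eq))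
  (Subₚ.x∈p⇒∣p-x∣<∣p∣ (f∈B here))

-- Dilworth's theorem

module FinitePoset {n : ℕ} {_≼_ : Rel (Fin n) 0ℓ} (isDPO : IsDecPartialOrder _≡_ _≼_) where
  open IsDecPartialOrder isDPO
    renaming (refl to ≼-refl; trans to ≼-trans; antisym to ≼-antisym; _≤?_ to _≼?_)
    using () public

  ↓ : Fin n → Subset n
  ↓ x = ⟦ (_≼? x) ⟧

  rank : Fin n → ℕ
  rank x = ∣ ↓ x ∣

  rank-≤ : ∀ x → rank x ℕ.≤ n
  rank-≤ x = Subₚ.∣p∣≤n (↓ x)

  rank-mono-< : ∀ {x y} → x ≼ y → x ≢ y → rank x ℕ.< rank y
  rank-mono-< {x} {y} x≼y x≢y = Subₚ.p⊂q⇒∣p∣<∣q∣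
    ( (λ z∈ → ∈⟦⟧⁺ (_≼? y) (≼-trans (∈⟦⟧⁻ (_≼? x) z∈) x≼y))
    , y , ∈⟦⟧⁺ (_≼? y) ≼-refl , λ y∈ → x≢y (≼-antisym x≼y (∈⟦⟧⁻ (_≼? x) y∈)))

  Comparable : Rel (Fin n) 0ℓ
  Comparable x y = x ≼ y ⊎ y ≼ x

  IsChain : Pred (Subset n) 0ℓ
  IsChain C = ∀ x y → x ∈ C → y ∈ C → Comparable x y

  IsAntichain : Pred (Subset n) 0ℓ
  IsAntichain A = ∀ x → x ∈ A → ∀ y → y ∈ A → x ≼ y → x ≡ y

  isAntichain? : Decidable IsAntichain
  isAntichain? A = Finₚ.all? λ x → (x Subₚ.∈? A) →-dec
    Finₚ.all? λ y → (y Subₚ.∈? A) →-dec ((x ≼? y) →-dec (x Finₚ.≟ y))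

  -- The chains may overlap, be empty or leave `S`. Thus k stands for "at most k", and no chain has
  -- to be trimmed when `S` shrinks.
  ChainCover : Subset n → ℕ → Set
  ChainCover S k = Σ (Fin k → Subset n) λ C →
    (∀ i → IsChain (C i)) × (∀ {x} → x ∈ S → ∃[ i ] x ∈ C i)

  AntichainsBounded : Subset n → ℕ → Set
  AntichainsBounded S k = ∀ A → IsAntichain A → A ⊆ S → ∣ A ∣ ℕ.≤ k

  FullAntichain : Subset n → ℕ → Pred (Subset n) 0ℓ
  FullAntichain S k A = IsAntichain A × A ⊆ S × ∣ A ∣ ≡ k

  fullAntichain? : ∀ S k → Decidable (FullAntichain S k)
  fullAntichain? S k A = isAntichain? A ×-dec (A Subₚ.⊆? S) ×-dec (∣ A ∣ ℕₚ.≟ k)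

  opaque
    -- A chain meets an antichain at most once, so such a colouring is injective; with `i` missed it
    -- would embed k elements into k - 1 colours.
    colouring-onto : ∀ {S k A} {C : Fin k → Subset n} → (∀ i → IsChain (C i)) → FullAntichain S k A →
                     (colour : ∀ {x} → x ∈ A → Fin k) →
                     (∀ {x} (x∈A : x ∈ A) → x ∈ C (colour x∈A)) →
                     ∀ i → ¬ (∀ {x} (x∈A : x ∈ A) → colour x∈A ≢ i)
    colouring-onto {k = k} {A} {C} chain (anti , _ , ∣A∣≡k) colour coloured i missed =
      ℕₚ.<⇒≢ (ℕₚ.≤-<-trans ∣A∣≤ ∣⊤-i∣<k) ∣A∣≡k
      where
      ∣A∣≤ : ∣ A ∣ ℕ.≤ ∣ ⊤ - i ∣
      ∣A∣≤ = ∣∣-injective A (⊤ - i) colour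
        (λ p → Subₚ.x∈p∧x≢y⇒x∈p-y Subₚ.∈⊤ (missed p))
        λ {x} {y} p q eq →
          [ anti x p y q , (λ y≼x → sym (anti y q x p y≼x)) ]′
            (chain (colour q) x y (subst (λ j → x ∈ C j) eq (coloured p)) (coloured q))
      ∣⊤-i∣<k : ∣ ⊤ - i ∣ ℕ.< k
      ∣⊤-i∣<k = subst (∣ ⊤ - i ∣ ℕ.<_) (Subₚ.∣⊤∣≡n k) (Subₚ.x∈p⇒∣p-x∣<∣p∣ (Subₚ.∈⊤ {x = i}))

    fullAntichain-meets : ∀ {S k A} (cover : ChainCover S k) → FullAntichain S k A →
                          ∀ i → ∃[ x ] (x ∈ A × x ∈ proj₁ cover i)
    fullAntichain-meets {A = A} (C , chain , covered) full@(_ , A⊆S , _) i =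
      decidable-stable (Finₚ.any? (λ x → (x Subₚ.∈? A) ×-dec (x Subₚ.∈? C i))) λ ¬meets →
        colouring-onto chain full (proj₁ ∘ covered ∘ A⊆S) (proj₂ ∘ covered ∘ A⊆S) i
          λ {x} p eq → ¬meets (x , p , subst (λ j → x ∈ C j) eq (proj₂ (covered (A⊆S p))))

    fullAntichain-chain-unique :
      ∀ {S k A} (cover : ChainCover S k) → FullAntichain S k A →
      ∀ {x i j} → x ∈ A → x ∈ proj₁ cover i → x ∈ proj₁ cover j → i ≡ j
    fullAntichain-chain-unique {k = k} {A} (C , chain , covered) full@(anti , A⊆S , _)
      {x} {i} {j} x∈A x∈Ci x∈Cj = decidable-stable (i Finₚ.≟ j) λ i≢j →
        colouring-onto chain full (λ p → proj₁ (recolour i≢j p))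
          (λ p → proj₁ (proj₂ (recolour i≢j p))) j (λ p → proj₂ (proj₂ (recolour i≢j p)))
      where
      recolour : i ≢ j → ∀ {y} → y ∈ A → Σ (Fin k) λ l → y ∈ C l × l ≢ j
      recolour i≢j {y} y∈A with covered (A⊆S y∈A)
      ... | l , y∈Cl with l Finₚ.≟ j
      ...   | no  l≢j  = l , y∈Cl , l≢j
      ...   | yes l≡j  = i , subst (_∈ C i) x≡y x∈Ci , i≢j
        where
        x≡y : x ≡ y
        x≡y = [ anti x x∈A y y∈A , (λ y≼x → sym (anti y y∈A x x∈A y≼x)) ]′
                (chain j x y x∈Cj (subst (λ h → y ∈ C h) l≡j y∈Cl))

  addChain : ∀ {S S′ k} (C : Subset n) → IsChain C → (∀ {x} → x ∈ S → x ∈ C ⊎ x ∈ S′) →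
             ChainCover S′ k → ChainCover S (suc k)
  addChain C chainC split (D , chainD , covered) = (C Vector.∷ D)
    , (λ { zero → chainC ; (suc i) → chainD i })
    , λ x∈S → [ (λ x∈C → zero , x∈C)
              , (λ x∈S′ → let i , x∈ = covered x∈S′ in suc i , x∈) ]′ (split x∈S)

  boundedBelow : ∀ {S S′ k} → AntichainsBounded S (suc k) → S′ ⊆ S →
                 (∀ A → ¬ FullAntichain S′ (suc k) A) → AntichainsBounded S′ k
  boundedBelow bounded S′⊆S ¬full A anti A⊆S′ = s≤s⁻¹ (ℕₚ.≤∧≢⇒<
    (bounded A anti (λ x∈ → S′⊆S (A⊆S′ x∈))) λ eq → ¬full A (anti , A⊆S′ , eq))

  singleton-antichain : ∀ a → IsAntichain ⁅ a ⁆
  singleton-antichain a x x∈ y y∈ _ =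
    trans (Subₚ.x∈⁅y⁆⇒x≡y a x∈) (sym (Subₚ.x∈⁅y⁆⇒x≡y a y∈))

  -- Galvin's proof: remove a maximal element a, cover the rest, and let top i
  -- be the largest element of the i-th chain on an antichain of size suc k.
  -- The elements top i form an antichain, so a lies above one of them, and
  -- removing a together with the part of that chain below top i lowers the
  -- width.
  module _ {S k} (bounded : AntichainsBounded S (suc k))
           {a} (a∈S : a ∈ S) (a-max : ∀ x → x ∈ S → a ≼ x → a ≡ x)
           (cover : ChainCover (S - a) (suc k))
           {A} (full : FullAntichain (S - a) (suc k) A) where

    private
      C = proj₁ cover
      C-chain = proj₁ (proj₂ cover)

      OnFull : Fin (suc k) → Pred (Fin n) 0ℓ
      OnFull i x = x ∈ C i × ∃[ A ] (FullAntichain (S - a) (suc k) A × x ∈ A)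

      onFull? : ∀ i → Decidable (OnFull i)
      onFull? i x = (x Subₚ.∈? C i) ×-dec
        Subₚ.anySubset? (λ A → fullAntichain? (S - a) (suc k) A ×-dec (x Subₚ.∈? A))

      opaque
        top-exists : ∀ i → ∃[ x ] (OnFull i x × (∀ y → OnFull i y → rank y ℕ.≤ rank x))
        top-exists i =
          let x , x∈A , x∈C = fullAntichain-meets cover full i
          in argmaxᶠ rank n rank-≤ (onFull? i) (x∈C , A , full , x∈A)

      top : Fin (suc k) → Fin n
      top i = proj₁ (top-exists i)

      top-onFull : ∀ i → OnFull i (top i)
      top-onFull i = proj₁ (proj₂ (top-exists i))

      -- Inside a chain, largest rank means greatest: anything strictly above `top i` would have
      -- larger rank.
      ≼top : ∀ {i y} → OnFull i y → y ≼ top i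
      ≼top {i} {y} good with C-chain i y (top i) (proj₁ good) (proj₁ (top-onFull i))
      ... | inj₁ y≼ = y≼
      ... | inj₂ top≼ with top i Finₚ.≟ y
      ...   | yes eq = subst (_≼ top i) eq ≼-refl
      ...   | no neq = contradiction (proj₂ (proj₂ (top-exists i)) y good)
                                     (ℕₚ.<⇒≱ (rank-mono-< top≼ neq))

      top∈S-a : ∀ i → top i ∈ S - a
      top∈S-a i = let _ , A , (_ , A⊆ , _) , top∈A = top-onFull i in A⊆ top∈A

      opaque
        -- A full antichain through `top j` meets `C i` in some y ≼ `top i` ≼ `top j`. Both ends lie
        -- in the antichain, so y is `top j`, which therefore lies in both chains.
        top-antichain : ∀ i j → top i ≼ top j → i ≡ j
        top-antichain i j ti≼tj =
          let _ , A , full@(anti , A⊆ , ∣A∣) , tj∈A = top-onFull j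
              y , y∈A , y∈C = fullAntichain-meets cover full i
              y≡tj = anti y y∈A (top j) tj∈A (≼-trans (≼top (y∈C , A , full , y∈A)) ti≼tj)
          in fullAntichain-chain-unique cover full tj∈A
               (subst (_∈ C i) y≡tj y∈C) (proj₁ (top-onFull j))

      AddedTop : Pred (Fin n) 0ℓ
      AddedTop x = x ≡ a ⊎ ∃[ i ] x ≡ top i

      addedTop? : Decidable AddedTop
      addedTop? x = (x Finₚ.≟ a) ⊎-dec Finₚ.any? (λ i → x Finₚ.≟ top i)

      top∈S : ∀ i → top i ∈ S
      top∈S i = proj₁ (x∈p─q⁻ S ⁅ a ⁆ (top∈S-a i))

      top≢a : ∀ i → top i ≢ a
      top≢a i eq = proj₂ (x∈p─q⁻ S ⁅ a ⁆ (top∈S-a i))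
                     (subst (_∈ ⁅ a ⁆) (sym eq) (Subₚ.x∈⁅x⁆ a))

      opaque
        -- Otherwise `a` and the k + 1 tops would form an antichain with k + 2 elements in `S`.
        top≼a : ∃[ i ] top i ≼ a
        top≼a = decidable-stable (Finₚ.any? λ i → top i ≼? a) λ ¬top≼a →
          ℕₚ.<⇒≱ ∣T∣> (bounded T (T-antichain ¬top≼a) T⊆S)
          where
          T : Subset n
          T = ⟦ addedTop? ⟧
          T⊆S : T ⊆ S
          T⊆S {x} x∈ with ∈⟦⟧⁻ addedTop? x∈
          ... | inj₁ refl       = a∈S
          ... | inj₂ (i , refl) = top∈S i
          T-antichain : ¬ (∃[ i ] top i ≼ a) → IsAntichain T
          T-antichain ¬top≼a x x∈ y y∈ x≼y with ∈⟦⟧⁻ addedTop? x∈ | ∈⟦⟧⁻ addedTop? y∈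
          ... | inj₁ refl       | _               = a-max y (T⊆S y∈) x≼y
          ... | inj₂ (i , refl) | inj₁ refl       = contradiction (i , x≼y) ¬top≼a
          ... | inj₂ (i , refl) | inj₂ (j , refl) = cong top (top-antichain i j x≼y)
          ∣T∣> : suc k ℕ.< ∣ T ∣
          ∣T∣> = subst (ℕ._≤ ∣ T ∣) (Subₚ.∣⊤∣≡n (suc (suc k)))
            (∣∣-injective ⊤ T (λ {i} _ → member i) (λ {i} _ → member∈ i)
              λ {i} {j} _ _ → member-injective i j)
            where
            member : Fin (suc (suc k)) → Fin n
            member zero    = a
            member (suc i) = top i
            member∈ : ∀ i → member i ∈ T
            member∈ zero    = ∈⟦⟧⁺ addedTop? (inj₁ refl)
            member∈ (suc i) = ∈⟦⟧⁺ addedTop? (inj₂ (i , refl))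
            member-injective : ∀ i j → member i ≡ member j → i ≡ j
            member-injective zero    zero    _  = refl
            member-injective zero    (suc j) eq = contradiction (sym eq) (top≢a j)
            member-injective (suc i) zero    eq = contradiction eq (top≢a i)
            member-injective (suc i) (suc j) eq = cong suc
              (top-antichain i j (subst (top i ≼_) eq ≼-refl))

      i₀ : Fin (suc k)
      i₀ = proj₁ top≼a

      InRemoved : Pred (Fin n) 0ℓ
      InRemoved x = x ≡ a ⊎ (x ∈ C i₀ × x ≼ top i₀)

      inRemoved? : Decidable InRemoved
      inRemoved? x = (x Finₚ.≟ a) ⊎-dec ((x Subₚ.∈? C i₀) ×-dec (x ≼? top i₀))

    removedChain : Subset n
    removedChain = ⟦ inRemoved? ⟧

    removedChain-chain : IsChain removedChain
    removedChain-chain x y x∈ y∈ = compare (∈⟦⟧⁻ inRemoved? x∈) (∈⟦⟧⁻ inRemoved? y∈)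
      where
      compare : InRemoved x → InRemoved y → Comparable x y
      compare (inj₁ refl)        (inj₁ refl)        = inj₁ ≼-refl
      compare (inj₁ refl)        (inj₂ (_ , y≼top)) = inj₂ (≼-trans y≼top (proj₂ top≼a))
      compare (inj₂ (_ , x≼top)) (inj₁ refl)        = inj₁ (≼-trans x≼top (proj₂ top≼a))
      compare (inj₂ (x∈C , _))   (inj₂ (y∈C , _))   = C-chain i₀ x y x∈C y∈C

    a∈removedChain : a ∈ removedChain
    a∈removedChain = ∈⟦⟧⁺ inRemoved? (inj₁ refl)

    -- Such a `B` would meet the chain `C i₀` in an element lying on a full antichain, hence below
    -- `top i₀`, and this part of the chain has been removed.
    width-drops : ∀ B → ¬ FullAntichain (S ─ removedChain) (suc k) B
    width-drops B (anti , B⊆ , ∣B∣) =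
      let x , x∈B , x∈C = fullAntichain-meets cover full′ i₀
      in proj₂ (x∈p─q⁻ S removedChain (B⊆ x∈B))
           (∈⟦⟧⁺ inRemoved? (inj₂ (x∈C , ≼top (x∈C , B , full′ , x∈B))))
      where
      full′ : FullAntichain (S - a) (suc k) B
      full′ = anti
        , (λ x∈B → let x∈S , x∉ = x∈p─q⁻ S removedChain (B⊆ x∈B) in
             Subₚ.x∈p∧x≢y⇒x∈p-y x∈S λ { refl → x∉ a∈removedChain })
        , ∣B∣

  dilworth : ∀ S k → AntichainsBounded S k → ChainCover S k
  dilworth S = cover (<-wellFounded ∣ S ∣)
    where
    cover : ∀ {S} → Acc ℕ._<_ ∣ S ∣ → ∀ k → AntichainsBounded S k → ChainCover S k
    cover {S} (acc rec) k bounded with Subₚ.nonempty? S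
    ... | no ¬nonempty = (λ _ → ⊥) , (λ _ _ _ x∈ → contradiction x∈ Subₚ.∉⊥)
                       , λ x∈S → contradiction (_ , x∈S) ¬nonempty
    cover {S} (acc rec) zero bounded | yes (x , x∈S) = contradiction
      (bounded ⁅ x ⁆ (singleton-antichain x)
        λ y∈ → subst (_∈ S) (sym (Subₚ.x∈⁅y⁆⇒x≡y x y∈)) x∈S)
      (subst (λ c → ¬ (c ℕ.≤ 0)) (sym (Subₚ.∣⁅x⁆∣≡1 x)) λ ())
    cover {S} (acc rec) (suc k) bounded | yes (x , x∈S)
      with argmaxᶠ rank n rank-≤ (Subₚ._∈? S) x∈S
    ... | a , a∈S , a-rank
      with Subₚ.anySubset? (fullAntichain? (S - a) (suc k))
    -- Here deleting `a` already lowers the width, so the singleton serves as the extra chain.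
    ...   | no ¬full = addChain ⁅ a ⁆
              (λ x y x∈ y∈ → inj₁ (subst (x ≼_) (singleton-≡ x∈ y∈) ≼-refl))
              split (cover (rec smaller) k
                (boundedBelow bounded (Subₚ.p─q⊆p S ⁅ a ⁆) λ A full → ¬full (A , full)))
      where
      smaller = Subₚ.x∈p⇒∣p-x∣<∣p∣ a∈S
      singleton-≡ : ∀ {x y} → x ∈ ⁅ a ⁆ → y ∈ ⁅ a ⁆ → x ≡ y
      singleton-≡ x∈ y∈ = trans (Subₚ.x∈⁅y⁆⇒x≡y a x∈) (sym (Subₚ.x∈⁅y⁆⇒x≡y a y∈))
      split : ∀ {x} → x ∈ S → x ∈ ⁅ a ⁆ ⊎ x ∈ S - a
      split {x} x∈S with x Subₚ.∈? ⁅ a ⁆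
      ... | yes x∈ = inj₁ x∈
      ... | no  x∉ = inj₂ (Subₚ.x∈p∧x∉q⇒x∈p─q x∈S x∉)
    ...   | yes (A , full) = addChain K (removedChain-chain bounded a∈S a-max IH full) split
              (cover (rec smaller) k
                (boundedBelow bounded (Subₚ.p─q⊆p S K)
                  (width-drops bounded a∈S a-max IH full)))
      where
      a-max : ∀ x → x ∈ S → a ≼ x → a ≡ x
      a-max x x∈S a≼x = decidable-stable (a Finₚ.≟ x) λ a≢x →
        ℕₚ.<⇒≱ (rank-mono-< a≼x a≢x) (a-rank x x∈S)
      IH : ChainCover (S - a) (suc k)
      IH = cover (rec (Subₚ.x∈p⇒∣p-x∣<∣p∣ a∈S)) (suc k)
        λ A anti A⊆ → bounded A anti (λ x∈ → Subₚ.p─q⊆p S ⁅ a ⁆ (A⊆ x∈))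
      K = removedChain bounded a∈S a-max IH full
      smaller : ∣ S ─ K ∣ ℕ.< ∣ S ∣
      smaller = Subₚ.p∩q≢∅⇒∣p─q∣<∣p∣ S K
        (a , Subₚ.x∈p∩q⁺ (a∈S , a∈removedChain bounded a∈S a-max IH full))
      split : ∀ {x} → x ∈ S → x ∈ K ⊎ x ∈ S ─ K
      split {x} x∈S with x Subₚ.∈? K
      ... | yes x∈ = inj₁ x∈
      ... | no  x∉ = inj₂ (Subₚ.x∈p∧x∉q⇒x∈p─q x∈S x∉)

-- Members as downsets of a poset, and its width against the VC-dimension

∣p∣≤∣p∩q∣+∣p─q∣ : ∀ (p q : Subset n) → ∣ p ∣ ℕ.≤ ∣ p ∩ q ∣ ℕ.+ ∣ p ─ q ∣
∣p∣≤∣p∩q∣+∣p─q∣ []            []            = z≤n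
∣p∣≤∣p∩q∣+∣p─q∣ (outside ∷ p) (outside ∷ q) = ∣p∣≤∣p∩q∣+∣p─q∣ p q
∣p∣≤∣p∩q∣+∣p─q∣ (outside ∷ p) (inside  ∷ q) = ∣p∣≤∣p∩q∣+∣p─q∣ p q
∣p∣≤∣p∩q∣+∣p─q∣ (inside  ∷ p) (outside ∷ q) =
  ℕₚ.≤-trans (s≤s (∣p∣≤∣p∩q∣+∣p─q∣ p q)) (ℕₚ.≤-reflexive (sym (ℕₚ.+-suc _ _)))
∣p∣≤∣p∩q∣+∣p─q∣ (inside  ∷ p) (inside  ∷ q) = s≤s (∣p∣≤∣p∩q∣+∣p─q∣ p q)

∣∣-covered : ∀ {d} (Ms : List (Subset n)) (A : Subset n) →
             (∀ {x} → x ∈ A → Any (x ∈_) Ms) →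
             (∀ {M} → M List.∈ Ms → ∣ A ∩ M ∣ ℕ.≤ d) →
             ∣ A ∣ ℕ.≤ length Ms ℕ.* d
∣∣-covered {n = n} [] A covered _ = ℕₚ.≤-trans
  (Subₚ.p⊆q⇒∣p∣≤∣q∣ {q = ⊥} λ x∈A → case covered x∈A of λ ()) (ℕₚ.≤-reflexive (Subₚ.∣⊥∣≡0 n))
∣∣-covered (M ∷ Ms) A covered small = ℕₚ.≤-trans (∣p∣≤∣p∩q∣+∣p─q∣ A M)
  (ℕₚ.+-mono-≤ (small (Any.here refl)) (∣∣-covered Ms (A ─ M) covered′ small′))
  where
  covered′ : ∀ {x} → x ∈ A ─ M → Any (x ∈_) Ms
  covered′ x∈ with x∈p─q⁻ A M x∈
  ... | x∈A , x∉M = Any.tail x∉M (covered x∈A)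
  small′ : ∀ {N} → N List.∈ Ms → ∣ (A ─ M) ∩ N ∣ ℕ.≤ _
  small′ {N} N∈ = ℕₚ.≤-trans
    (Subₚ.p⊆q⇒∣p∣≤∣q∣ λ x∈ → let x∈A─M , x∈N = Subₚ.x∈p∩q⁻ (A ─ M) N x∈ in
      Subₚ.x∈p∩q⁺ (Subₚ.p─q⊆p A M x∈A─M , x∈N))
    (small (Any.there N∈))

Precedes : SetSystem n → Rel (Fin n) 0ℓ
Precedes 𝒞 f e = ∀ X → 𝒞 X → e ∈ X → f ∈ X

-- The common core of bouquets and median set systems: it makes the members
-- the downsets of a poset that lie inside some member.
record IsDownsetSystem (𝒞 : SetSystem n) : Set where
  field
    ∅-member  : 𝒞 ⊥
    ∩-closed  : ∀ X Y → 𝒞 X → 𝒞 Y → 𝒞 (X ∩ Y)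
    bounded-∪ : ∀ X Y → 𝒞 X → 𝒞 Y → (∃[ Z ] (𝒞 Z × (X ∪ Y) ⊆ Z)) → 𝒞 (X ∪ Y)
    antisym   : ∀ {e f} → Precedes 𝒞 e f → Precedes 𝒞 f e → e ≡ f

bouquet⇒downsetSystem : {𝒞 : SetSystem n} → Decidable 𝒞 → Covers 𝒞 →
                        IsBouquetOfDownsetAlignments 𝒞 → IsDownsetSystem 𝒞
bouquet⇒downsetSystem {𝒞 = 𝒞} 𝒞? covers B = record
  { ∅-member = ∅-member ; ∩-closed = ∩-closed ; bounded-∪ = bounded-∪ ; antisym = antisym }
  where
  open IsBouquetOfDownsetAlignments B
  -- A largest member Y with e ∉ Y inside a member X ∋ e can only be extended
  -- by e, whence f ∈ Y or f ≡ e.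
  antisym : ∀ {e f} → Precedes 𝒞 e f → Precedes 𝒞 f e → e ≡ f
  antisym {e} {f} e≼f f≼e with covers e
  ... | X , 𝒞X , e∈X
    with largest (λ Y → 𝒞? Y ×-dec (Y Subₚ.⊆? X) ×-dec ¬? (e Subₚ.∈? Y))
                 (∅-member , Subₚ.⊥⊆ , Subₚ.∉⊥)
  ... | Y , (𝒞Y , Y⊆X , e∉Y) , Y-largest
    with extension X Y 𝒞X 𝒞Y (Y⊆X , e , e∈X , e∉Y)
  ... | g , g∈X , g∉Y , 𝒞Yg with e Finₚ.≟ g
  ...   | yes refl with Subₚ.x∈p∪q⁻ Y ⁅ e ⁆
                          (f≼e (Y ∪ ⁅ e ⁆) 𝒞Yg (Subₚ.q⊆p∪q Y ⁅ e ⁆ (Subₚ.x∈⁅x⁆ e)))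
  ...     | inj₁ f∈Y = contradiction (e≼f Y 𝒞Y f∈Y) e∉Y
  ...     | inj₂ f∈e = sym (Subₚ.x∈⁅y⁆⇒x≡y e f∈e)
  antisym {e} {f} e≼f f≼e | X , 𝒞X , e∈X | Y , (𝒞Y , Y⊆X , e∉Y) , Y-largest
    | g , g∈X , g∉Y , 𝒞Yg | no e≢g =
    contradiction (Y-largest (Y ∪ ⁅ g ⁆) (𝒞Yg , Yg⊆X , e∉Yg)) (ℕₚ.<⇒≱ (Subₚ.p⊂q⇒∣p∣<∣q∣
      (Subₚ.p⊆p∪q ⁅ g ⁆ , g , Subₚ.q⊆p∪q Y ⁅ g ⁆ (Subₚ.x∈⁅x⁆ g) , g∉Y)))
    where
    Yg⊆X : (Y ∪ ⁅ g ⁆) ⊆ X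
    Yg⊆X {x} x∈ with Subₚ.x∈p∪q⁻ Y ⁅ g ⁆ x∈
    ... | inj₁ x∈Y = Y⊆X x∈Y
    ... | inj₂ x∈g = subst (_∈ X) (sym (Subₚ.x∈⁅y⁆⇒x≡y g x∈g)) g∈X
    e∉Yg : e ∉ (Y ∪ ⁅ g ⁆)
    e∉Yg e∈ with Subₚ.x∈p∪q⁻ Y ⁅ g ⁆ e∈
    ... | inj₁ e∈Y = e∉Y e∈Y
    ... | inj₂ e∈g = e≢g (Subₚ.x∈⁅y⁆⇒x≡y g e∈g)

median⇒downsetSystem : {𝒞 : SetSystem n} → IsMedian 𝒞 → IsDownsetSystem 𝒞
median⇒downsetSystem {n = n} {𝒞 = 𝒞} M = record
  { ∅-member = ∅-member ; ∩-closed = ∩-closed ; bounded-∪ = bounded-∪ ; antisym = antisym }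
  where
  open IsMedian M
  -- `triple-∪` applies to the triples (X, Y, ∅) and (Y, X, Z): the pairwise unions Y ∪ ∅, X ∪ ∅ and
  -- X ∪ Y lie in Y, X and Z respectively.
  bounded-∪ : ∀ X Y → 𝒞 X → 𝒞 Y → (∃[ Z ] (𝒞 Z × (X ∪ Y) ⊆ Z)) → 𝒞 (X ∪ Y)
  bounded-∪ X Y 𝒞X 𝒞Y (Z , 𝒞Z , XY⊆Z) =
    subst 𝒞 (cong (X ∪_) (Subₚ.∪-identityʳ Y)) (triple-∪ K L K∈ L∈ K∪K⊆L)
    where
    K L : Fin 3 → Subset n
    K zero             = X
    K (suc zero)       = Y
    K (suc (suc zero)) = ⊥
    L zero             = Y
    L (suc zero)       = X
    L (suc (suc zero)) = Z
    K∈ : ∀ i → 𝒞 (K i)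
    K∈ zero             = 𝒞X
    K∈ (suc zero)       = 𝒞Y
    K∈ (suc (suc zero)) = ∅-member
    L∈ : ∀ i → 𝒞 (L i)
    L∈ zero             = 𝒞Y
    L∈ (suc zero)       = 𝒞X
    L∈ (suc (suc zero)) = 𝒞Z
    ∪⊆ : ∀ {P Q R : Subset n} → P ⊆ R → Q ⊆ R → (P ∪ Q) ⊆ R
    ∪⊆ {P} {Q} P⊆R Q⊆R x∈ = [ P⊆R , Q⊆R ]′ (Subₚ.x∈p∪q⁻ P Q x∈)
    K⊆L : ∀ i k → i ≢ k → K i ⊆ L k
    K⊆L zero             zero             i≢k = contradiction refl i≢k
    K⊆L zero             (suc zero)       i≢k = id
    K⊆L zero             (suc (suc zero)) i≢k = λ x∈ → XY⊆Z (Subₚ.p⊆p∪q Y x∈)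
    K⊆L (suc zero)       zero             i≢k = id
    K⊆L (suc zero)       (suc zero)       i≢k = contradiction refl i≢k
    K⊆L (suc zero)       (suc (suc zero)) i≢k = λ x∈ → XY⊆Z (Subₚ.q⊆p∪q X Y x∈)
    K⊆L (suc (suc zero)) k                i≢k = Subₚ.⊥⊆
    K∪K⊆L : ∀ i j k → i ≢ j → j ≢ k → i ≢ k → (K i ∪ K j) ⊆ L k
    K∪K⊆L i j k _ j≢k i≢k = ∪⊆ {K i} {K j} (K⊆L i k i≢k) (K⊆L j k j≢k)
  -- Under mutual precedence each member contains both or neither of `e` and `f`, so its trace on
  -- the pair has size 2 or 0, never 1.
  antisym : ∀ {e f} → Precedes 𝒞 e f → Precedes 𝒞 f e → e ≡ f
  antisym {e} {f} e≼f f≼e = decidable-stable (e Finₚ.≟ f) λ e≢f →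
    let K , 𝒞K , one = separation e f e≢f in not-one e≢f K 𝒞K (e Subₚ.∈? K) one
    where
    not-one : e ≢ f → ∀ K → 𝒞 K → Dec (e ∈ K) → ∣ (⁅ e ⁆ ∪ ⁅ f ⁆) ∩ K ∣ ≢ 1
    not-one e≢f K 𝒞K (yes e∈K) one = ℕₚ.<⇒≢ (subst (ℕ._< ∣ (⁅ e ⁆ ∪ ⁅ f ⁆) ∩ K ∣) (Subₚ.∣⁅x⁆∣≡1 e)
      (Subₚ.p⊂q⇒∣p∣<∣q∣ (e⊆ , f , Subₚ.x∈p∩q⁺
          (Subₚ.q⊆p∪q ⁅ e ⁆ ⁅ f ⁆ (Subₚ.x∈⁅x⁆ f) , f≼e K 𝒞K e∈K)
        , Subₚ.x≢y⇒x∉⁅y⁆ (e≢f ∘ sym)))) (sym one)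
      where
      e⊆ : ⁅ e ⁆ ⊆ ((⁅ e ⁆ ∪ ⁅ f ⁆) ∩ K)
      e⊆ {x} x∈ = Subₚ.x∈p∩q⁺
        (Subₚ.p⊆p∪q ⁅ f ⁆ x∈ , subst (_∈ K) (sym (Subₚ.x∈⁅y⁆⇒x≡y e x∈)) e∈K)
    not-one e≢f K 𝒞K (no e∉K) one = contradiction one (subst (_≢ 1)
      (sym (trans (cong ∣_∣ (Subₚ.Empty-unique empty)) (Subₚ.∣⊥∣≡0 n))) λ ())
      where
      empty : ¬ (∃[ x ] x ∈ ((⁅ e ⁆ ∪ ⁅ f ⁆) ∩ K))
      empty (x , x∈) with Subₚ.x∈p∩q⁻ (⁅ e ⁆ ∪ ⁅ f ⁆) K x∈
      ... | x∈ef , x∈K with Subₚ.x∈p∪q⁻ ⁅ e ⁆ ⁅ f ⁆ x∈ef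
      ...   | inj₁ x∈e = e∉K (subst (_∈ K) (Subₚ.x∈⁅y⁆⇒x≡y e x∈e) x∈K)
      ...   | inj₂ x∈f = e∉K (e≼f K 𝒞K (subst (_∈ K) (Subₚ.x∈⁅y⁆⇒x≡y f x∈f) x∈K))

maximal-above : {𝒞 : SetSystem n} → Decidable 𝒞 → ∀ {X} → 𝒞 X →
                ∃[ M ] (IsMaximalMember 𝒞 M × X ⊆ M)
maximal-above 𝒞? {X} 𝒞X with largest (λ Y → 𝒞? Y ×-dec (X Subₚ.⊆? Y)) (𝒞X , id)
... | M , (𝒞M , X⊆M) , M-largest = M
  , (𝒞M , λ Y 𝒞Y M⊆Y → ⊆∧∣∣≤⇒≡ M⊆Y (M-largest Y (𝒞Y , λ x∈ → M⊆Y (X⊆M x∈)))) , X⊆M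

module DownsetSystem {n} {𝒞 : SetSystem n} (𝒞? : Decidable 𝒞) (sys : IsDownsetSystem 𝒞)
                     (covers : Covers 𝒞) where
  open IsDownsetSystem sys

  precedes? : ∀ f e → Dec (Precedes 𝒞 f e)
  precedes? f e = map′
    (λ none X 𝒞X e∈X → decidable-stable (f Subₚ.∈? X) λ f∉X → none (X , 𝒞X , e∈X , f∉X))
    (λ f≼e (X , 𝒞X , e∈X , f∉X) → f∉X (f≼e X 𝒞X e∈X))
    (¬? (Subₚ.anySubset? λ X → 𝒞? X ×-dec (e Subₚ.∈? X) ×-dec ¬? (f Subₚ.∈? X)))

  precedes-isDecPartialOrder : IsDecPartialOrder _≡_ (Precedes 𝒞)
  precedes-isDecPartialOrder = record
    { isPartialOrder = record
      { isPreorder = record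
        { isEquivalence = isEquivalence
        ; reflexive = λ { refl _ _ e∈X → e∈X }
        ; trans = λ f≼e e≼g X 𝒞X g∈X → f≼e X 𝒞X (e≼g X 𝒞X g∈X)
        }
      ; antisym = antisym
      }
    ; _≟_ = Finₚ._≟_
    ; _≤?_ = precedes?
    }

  open FinitePoset precedes-isDecPartialOrder public

  _≼_ : Rel (Fin n) 0ℓ
  _≼_ = Precedes 𝒞

  -- A smallest member through `e` stays the same when intersected with any other member through
  -- `e`, so it is the intersection of all of them, which is `↓ e`.
  ↓-member : ∀ e → 𝒞 (↓ e)
  ↓-member e with covers e
  ... | X , 𝒞X , e∈X
    with smallest (λ Y → 𝒞? Y ×-dec (e Subₚ.∈? Y)) (𝒞X , e∈X)
  ... | Y , (𝒞Y , e∈Y) , Y-smallest = subst 𝒞 (Subₚ.⊆-antisym Y⊆↓e ↓e⊆Y) 𝒞Y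
    where
    Y⊆↓e : Y ⊆ ↓ e
    Y⊆↓e f∈Y = ∈⟦⟧⁺ (_≼? e) λ Z 𝒞Z e∈Z → proj₁ (Subₚ.x∈p∩q⁻ Z Y
      (subst (_ ∈_) (sym (⊆∧∣∣≤⇒≡ (Subₚ.p∩q⊆q Z Y)
        (Y-smallest (Z ∩ Y) (∩-closed Z Y 𝒞Z 𝒞Y , Subₚ.x∈p∩q⁺ (e∈Z , e∈Y))))) f∈Y))
    ↓e⊆Y : ↓ e ⊆ Y
    ↓e⊆Y f∈↓e = ∈⟦⟧⁻ (_≼? e) f∈↓e Y 𝒞Y e∈Y

  -- `X` is the union of the principal downsets `↓ e` with e in X. All are members below `Z`, so
  -- `bounded-∪` lets a largest member inside `X` absorb each of them.
  bounded-downset-member : ∀ {X Z} → (∀ {e f} → f ≼ e → e ∈ X → f ∈ X) →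
                           𝒞 Z → X ⊆ Z → 𝒞 X
  bounded-downset-member {X} {Z} closed 𝒞Z X⊆Z
    with largest (λ Y → 𝒞? Y ×-dec (Y Subₚ.⊆? X)) (∅-member , Subₚ.⊥⊆)
  ... | Y , (𝒞Y , Y⊆X) , Y-largest = subst 𝒞 (Subₚ.⊆-antisym Y⊆X X⊆Y) 𝒞Y
    where
    X⊆Y : X ⊆ Y
    X⊆Y {e} e∈X = decidable-stable (e Subₚ.∈? Y) λ e∉Y →
      ℕₚ.<⇒≱ (Subₚ.p⊂q⇒∣p∣<∣q∣ (Subₚ.p⊆p∪q (↓ e) , e
               , Subₚ.q⊆p∪q Y (↓ e) (∈⟦⟧⁺ (_≼? e) ≼-refl) , e∉Y))
             (Y-largest (Y ∪ ↓ e)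
               (bounded-∪ Y (↓ e) 𝒞Y (↓-member e) (Z , 𝒞Z , λ x∈ → X⊆Z (Y↓e⊆X x∈)) , Y↓e⊆X))
      where
      Y↓e⊆X : (Y ∪ ↓ e) ⊆ X
      Y↓e⊆X x∈ with Subₚ.x∈p∪q⁻ Y (↓ e) x∈
      ... | inj₁ x∈Y  = Y⊆X x∈Y
      ... | inj₂ x∈↓e = closed (∈⟦⟧⁻ (_≼? e) x∈↓e) e∈X

  -- The trace `Y` is cut out by the downset generated by `Y`: it adds no element of an antichain
  -- `A`, and it stays inside the downset `M`.
  antichain-shattered : ∀ {A M} → IsAntichain A → 𝒞 M → A ⊆ M → Shatters 𝒞 A
  antichain-shattered {A} {M} anti 𝒞M A⊆M Y Y⊆A =
    S , bounded-downset-member S-closed 𝒞M S⊆M , Subₚ.⊆-antisym S∩A⊆Y Y⊆S∩A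
    where
    BelowY : Pred (Fin n) 0ℓ
    BelowY f = ∃[ e ] (e ∈ Y × f ≼ e)
    belowY? : Decidable BelowY
    belowY? f = Finₚ.any? λ e → (e Subₚ.∈? Y) ×-dec (f ≼? e)
    S : Subset n
    S = ⟦ belowY? ⟧
    S-closed : ∀ {e f} → f ≼ e → e ∈ S → f ∈ S
    S-closed f≼e e∈S = let g , g∈Y , e≼g = ∈⟦⟧⁻ belowY? e∈S in
      ∈⟦⟧⁺ belowY? (g , g∈Y , ≼-trans f≼e e≼g)
    S⊆M : S ⊆ M
    S⊆M f∈S = let e , e∈Y , f≼e = ∈⟦⟧⁻ belowY? f∈S in f≼e M 𝒞M (A⊆M (Y⊆A e∈Y))
    S∩A⊆Y : (S ∩ A) ⊆ Y
    S∩A⊆Y {f} f∈ =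
      let f∈S , f∈A = Subₚ.x∈p∩q⁻ S A f∈
          e , e∈Y , f≼e = ∈⟦⟧⁻ belowY? f∈S
      in subst (_∈ Y) (sym (anti f f∈A e (Y⊆A e∈Y) f≼e)) e∈Y
    Y⊆S∩A : Y ⊆ (S ∩ A)
    Y⊆S∩A {e} e∈Y = Subₚ.x∈p∩q⁺ (∈⟦⟧⁺ belowY? (e , e∈Y , ≼-refl) , Y⊆A e∈Y)

  antichain-bound : ∀ {ℓ d} → HasMaximalMembers 𝒞 ℓ → IsVCDimension 𝒞 d →
                    ∀ A → IsAntichain A → ∣ A ∣ ℕ.≤ n ⊓ (ℓ ℕ.* d)
  antichain-bound {d = d} (Ms , _ , maximal , refl) (_ , vc) A anti =
    ℕₚ.⊓-glb (Subₚ.∣p∣≤n A) (∣∣-covered Ms A covered small)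
    where
    covered : ∀ {x} → x ∈ A → Any (x ∈_) Ms
    covered {x} _ =
      let X , 𝒞X , x∈X = covers x
          M , M-max , X⊆M = maximal-above 𝒞? 𝒞X
      in List.lose (Equivalence.from (maximal M) M-max) (X⊆M x∈X)
    small : ∀ {M} → M List.∈ Ms → ∣ A ∩ M ∣ ℕ.≤ d
    small {M} M∈ = vc (A ∩ M) (antichain-shattered
      (λ x x∈ y y∈ → anti x (Subₚ.p∩q⊆p A M x∈) y (Subₚ.p∩q⊆p A M y∈))
      (proj₁ (Equivalence.to (maximal M) M∈)) (Subₚ.p∩q⊆q A M))

  chain-colouring : ∀ {ℓ d} → HasMaximalMembers 𝒞 ℓ → IsVCDimension 𝒞 d →
    Σ (Fin n → Fin (n ⊓ (ℓ ℕ.* d))) λ c → ∀ e f → c e ≡ c f → Comparable e f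
  chain-colouring {ℓ} {d} maximal vc
    with dilworth ⊤ (n ⊓ (ℓ ℕ.* d)) (λ A anti _ → antichain-bound maximal vc A anti)
  ... | C , chain , covered =
    (λ e → proj₁ (covered {e} Subₚ.∈⊤)) , λ e f ce≡cf →
      chain _ e f (proj₂ (covered Subₚ.∈⊤))
        (subst (λ i → f ∈ C i) (sym ce≡cf) (proj₂ (covered Subₚ.∈⊤)))

-- Ordered field arithmetic

opaque
  -- Most later estimates are certificates of this shape: the difference of the two sides is written
  -- as a sum of visibly nonnegative products, with a positive one if needed, and the ring solver
  -- checks the identity.
  0<+⇒< : 0ℚ ℚ.< r → p ℚ.+ r ≡ q → p ℚ.< q
  0<+⇒< {r} {p} 0<r refl = subst (ℚ._< p ℚ.+ r) (ℚₚ.+-identityʳ p) (ℚₚ.+-monoʳ-< p 0<r)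

  0≤+⇒≤ : 0ℚ ℚ.≤ r → p ℚ.+ r ≡ q → p ℚ.≤ q
  0≤+⇒≤ {r} {p} 0≤r refl = subst (ℚ._≤ p ℚ.+ r) (ℚₚ.+-identityʳ p) (ℚₚ.+-monoʳ-≤ p 0≤r)

  <⇒0< : p ℚ.< q → 0ℚ ℚ.< q ℚ.- p
  <⇒0< {p} {q} p<q = subst (ℚ._< q ℚ.- p) (ℚₚ.+-inverseʳ p) (ℚₚ.+-monoˡ-< (ℚ.- p) p<q)

  ≤⇒0≤ : p ℚ.≤ q → 0ℚ ℚ.≤ q ℚ.- p
  ≤⇒0≤ {p} {q} p≤q = subst (ℚ._≤ q ℚ.- p) (ℚₚ.+-inverseʳ p) (ℚₚ.+-monoˡ-≤ (ℚ.- p) p≤q)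

  0<+0< : 0ℚ ℚ.< p → 0ℚ ℚ.< q → 0ℚ ℚ.< p ℚ.+ q
  0<+0< = ℚₚ.+-mono-<

  0<+0≤ : 0ℚ ℚ.< p → 0ℚ ℚ.≤ q → 0ℚ ℚ.< p ℚ.+ q
  0<+0≤ = ℚₚ.+-mono-<-≤

  0≤+0≤ : 0ℚ ℚ.≤ p → 0ℚ ℚ.≤ q → 0ℚ ℚ.≤ p ℚ.+ q
  0≤+0≤ = ℚₚ.+-mono-≤

  0<*0< : 0ℚ ℚ.< p → 0ℚ ℚ.< q → 0ℚ ℚ.< p ℚ.* q
  0<*0< {p} {q} 0<p 0<q =
    ℚₚ.positive⁻¹ _ {{ℚₚ.pos*pos⇒pos p {{ℚ.positive 0<p}} q {{ℚ.positive 0<q}}}}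

  0≤*0≤ : 0ℚ ℚ.≤ p → 0ℚ ℚ.≤ q → 0ℚ ℚ.≤ p ℚ.* q
  0≤*0≤ {p} {q} 0≤p 0≤q =
    ℚₚ.nonNegative⁻¹ _ {{ℚₚ.nonNeg*nonNeg⇒nonNeg p {{ℚ.nonNegative 0≤p}} q {{ℚ.nonNegative 0≤q}}}}

  p≤∣p∣ : ∀ p → p ℚ.≤ ℚ.∣ p ∣
  p≤∣p∣ p with ℚₚ.≤-total 0ℚ p
  ... | inj₁ 0≤p = ℚₚ.≤-reflexive (sym (ℚₚ.0≤p⇒∣p∣≡p 0≤p))
  ... | inj₂ p≤0 = ℚₚ.≤-trans p≤0 (ℚₚ.0≤∣p∣ p)

  -∣p∣≤p : ∀ p → ℚ.- ℚ.∣ p ∣ ℚ.≤ p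
  -∣p∣≤p p = subst (ℚ.- ℚ.∣ p ∣ ℚ.≤_) (neg-neg p)
    (ℚₚ.neg-antimono-≤ (subst (ℚ.- p ℚ.≤_) (ℚₚ.∣-p∣≡∣p∣ p) (p≤∣p∣ (ℚ.- p))))
    where
    open +-*-Solver
    neg-neg : ∀ p → ℚ.- (ℚ.- p) ≡ p
    neg-neg = solve 1 (λ p → :- (:- p) := p) refl

  *≤∣∣* : ∀ p q r → ℚ.∣ q ∣ ℚ.≤ r → p ℚ.* q ℚ.≤ ℚ.∣ p ∣ ℚ.* r
  *≤∣∣* p q r q≤r = ℚₚ.≤-trans (p≤∣p∣ (p ℚ.* q))
    (ℚₚ.≤-trans (ℚₚ.≤-reflexive (ℚₚ.∣p*q∣≡∣p∣*∣q∣ p q))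
      (ℚₚ.*-monoˡ-≤-nonNeg ℚ.∣ p ∣ {{ℚₚ.∣-∣-nonNeg p}} q≤r))

  ∣p-q∣≡∣q-p∣ : ∀ p q → ℚ.∣ p ℚ.- q ∣ ≡ ℚ.∣ q ℚ.- p ∣
  ∣p-q∣≡∣q-p∣ p q = trans (cong ℚ.∣_∣ (swap p q)) (ℚₚ.∣-p∣≡∣p∣ (q ℚ.- p))
    where
    open +-*-Solver
    swap : ∀ p q → p ℚ.- q ≡ ℚ.- (q ℚ.- p)
    swap = solve 2 (λ p q → p :- q := :- (q :- p)) refl

  ∣∣<⁺ : ∀ p q → p ℚ.- q ℚ.< r → q ℚ.- p ℚ.< r → ℚ.∣ p ℚ.- q ∣ ℚ.< r
  ∣∣<⁺ {r} p q h₁ h₂ with ℚₚ.∣p∣≡p∨∣p∣≡-p (p ℚ.- q)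
  ... | inj₁ eq = subst (ℚ._< r) (sym eq) h₁
  ... | inj₂ eq = subst (ℚ._< r) (sym (trans eq (swap p q))) h₂
    where
    open +-*-Solver
    swap : ∀ p q → ℚ.- (p ℚ.- q) ≡ q ℚ.- p
    swap = solve 2 (λ p q → :- (p :- q) := q :- p) refl

opaque
  positive-lower-bound : 0ℚ ℚ.< p → 0ℚ ℚ.< q → ∃[ r ] (0ℚ ℚ.< r × r ℚ.≤ p × r ℚ.≤ q)
  positive-lower-bound {p} {q} 0<p 0<q with ℚₚ.≤-total p q
  ... | inj₁ p≤q = p , 0<p , ℚₚ.≤-refl , p≤q
  ... | inj₂ q≤p = q , 0<q , q≤p , ℚₚ.≤-refl

-- Affine forms over the rationals and the reals

-- The list of (w , β , j) stands for the form z ↦ ∑ (w zⱼ + β).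
Form : ℕ → Set
Form m = List (ℚ × ℚ × Fin m)

eval : Form m → (Fin m → ℚ) → ℚ
eval []              z = 0ℚ
eval ((w , β , j) ∷ F) z = (w ℚ.* z j ℚ.+ β) ℚ.+ eval F z

evalℝ : Form m → ℝ^ m → ℝ
evalℝ []              x = 0ℝ
evalℝ ((w , β , j) ∷ F) x = (fromℚ w *ℝ x j +ℝ fromℚ β) +ℝ evalℝ F x

-- The value at the origin, and a Lipschitz constant for the maximum norm.
constant lipschitz : Form m → ℚ
constant []              = 0ℚ
constant ((w , β , j) ∷ F) = β ℚ.+ constant F
lipschitz []              = 0ℚ
lipschitz ((w , β , j) ∷ F) = ℚ.∣ w ∣ ℚ.+ lipschitz F

at : ℝ^ m → ℕ → Fin m → ℚ
at x i j = seq (x j) i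

-- Real arithmetic acts termwise on sequences, so statements about a form on real points reduce to
-- rational estimates at a single index.
seq-evalℝ : ∀ (F : Form m) x i → seq (evalℝ F x) i ≡ eval F (at x i)
seq-evalℝ []                x i = refl
seq-evalℝ ((w , β , j) ∷ F) x i = cong (w ℚ.* seq (x j) i ℚ.+ β ℚ.+_) (seq-evalℝ F x i)

opaque
  -- Real weights with sum 1 have approximants whose sum is only near 1; the last term is the
  -- resulting defect of affinity.
  eval-combination : ∀ (F : Form m) s t a b →
    eval F (λ j → s ℚ.* a j ℚ.+ t ℚ.* b j) ≡
    s ℚ.* eval F a ℚ.+ t ℚ.* eval F b ℚ.+ (1ℚ ℚ.- (s ℚ.+ t)) ℚ.* constant F
  eval-combination [] s t a b = base s t
    where
    open +-*-Solver
    base : ∀ s t → 0ℚ ≡ s ℚ.* 0ℚ ℚ.+ t ℚ.* 0ℚ ℚ.+ (1ℚ ℚ.- (s ℚ.+ t)) ℚ.* 0ℚ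
    base = solve 2 (λ s t → con 0ℚ :=
      s :* con 0ℚ :+ t :* con 0ℚ :+ (con 1ℚ :- (s :+ t)) :* con 0ℚ) refl
  eval-combination ((w , β , j) ∷ F) s t a b = trans
    (cong (w ℚ.* (s ℚ.* a j ℚ.+ t ℚ.* b j) ℚ.+ β ℚ.+_) (eval-combination F s t a b))
    (step w β s t (a j) (b j) (eval F a) (eval F b) (constant F))
    where
    open +-*-Solver
    step : ∀ w β s t x y A B κ →
      w ℚ.* (s ℚ.* x ℚ.+ t ℚ.* y) ℚ.+ β ℚ.+ (s ℚ.* A ℚ.+ t ℚ.* B ℚ.+ (1ℚ ℚ.- (s ℚ.+ t)) ℚ.* κ) ≡
      s ℚ.* ((w ℚ.* x ℚ.+ β) ℚ.+ A) ℚ.+ t ℚ.* ((w ℚ.* y ℚ.+ β) ℚ.+ B)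
        ℚ.+ (1ℚ ℚ.- (s ℚ.+ t)) ℚ.* (β ℚ.+ κ)
    step = solve 9 (λ w β s t x y A B κ →
      w :* (s :* x :+ t :* y) :+ β :+ (s :* A :+ t :* B :+ (con 1ℚ :- (s :+ t)) :* κ) :=
      s :* ((w :* x :+ β) :+ A) :+ t :* ((w :* y :+ β) :+ B)
        :+ (con 1ℚ :- (s :+ t)) :* (β :+ κ)) refl

  lipschitz-nonNeg : ∀ (F : Form m) → 0ℚ ℚ.≤ lipschitz F
  lipschitz-nonNeg []                = ℚₚ.≤-refl
  lipschitz-nonNeg ((w , _ , _) ∷ F) = 0≤+0≤ (ℚₚ.0≤∣p∣ w) (lipschitz-nonNeg F)

  eval-lipschitz : ∀ (F : Form m) {ε} a b → (∀ j → ℚ.∣ b j ℚ.- a j ∣ ℚ.≤ ε) →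
                   eval F b ℚ.≤ eval F a ℚ.+ lipschitz F ℚ.* ε
  eval-lipschitz [] {ε} a b close = ℚₚ.≤-reflexive
    (sym (trans (ℚₚ.+-identityˡ _) (ℚₚ.*-zeroˡ ε)))
  eval-lipschitz ((w , β , j) ∷ F) {ε} a b close = 0≤+⇒≤
    (0≤+0≤ (≤⇒0≤ (*≤∣∣* w (b j ℚ.- a j) ε (close j))) (≤⇒0≤ (eval-lipschitz F a b close)))
    (step w β (a j) (b j) (eval F a) (eval F b) ℚ.∣ w ∣ (lipschitz F) ε)
    where
    open +-*-Solver
    step : ∀ w β x y A B v L ε →
      w ℚ.* y ℚ.+ β ℚ.+ B ℚ.+ ((v ℚ.* ε ℚ.- w ℚ.* (y ℚ.- x)) ℚ.+ ((A ℚ.+ L ℚ.* ε) ℚ.- B)) ≡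
      w ℚ.* x ℚ.+ β ℚ.+ A ℚ.+ (v ℚ.+ L) ℚ.* ε
    step = solve 9 (λ w β x y A B v L ε →
      w :* y :+ β :+ B :+ ((v :* ε :- w :* (y :- x)) :+ ((A :+ L :* ε) :- B)) :=
      w :* x :+ β :+ A :+ (v :+ L) :* ε) refl

-- Open half-spaces: openness and convexity along Cauchy sequences

Eventually : Pred ℕ 0ℓ → Set
Eventually P = ∃[ N ] (∀ i → N ℕ.≤ i → P i)

eventually-∧ : {P Q : Pred ℕ 0ℓ} → Eventually P → Eventually Q → Eventually (λ i → P i × Q i)
eventually-∧ (M , p) (N , q) = M ℕ.⊔ N , λ i i≥ →
  p i (ℕₚ.m⊔n≤o⇒m≤o M N i≥) , q i (ℕₚ.m⊔n≤o⇒n≤o M N i≥)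

eventually-map : {P Q : Pred ℕ 0ℓ} → (∀ i → P i → Q i) → Eventually P → Eventually Q
eventually-map f (N , p) = N , λ i i≥ → f i (p i i≥)

eventually-∀ : {P : Fin m → Pred ℕ 0ℓ} → (∀ j → Eventually (P j)) →
               Eventually (λ i → ∀ j → P j i)
eventually-∀ {zero}  ev = 0 , λ _ _ ()
eventually-∀ {suc m} ev with eventually-∧ (ev zero) (eventually-∀ (ev ∘ suc))
... | N , h = N , λ { i i≥ zero → proj₁ (h i i≥) ; i i≥ (suc j) → proj₂ (h i i≥) j }

-- Weak enough to follow both from equality of real vectors and from membership in an open box, so
-- one neighbourhood statement yields openness and invariance under `≈ᵛ`.
Close : ℚ → ℝ^ m → ℝ^ m → Set
Close ε x y = ∀ j → Eventually (λ i → ℚ.∣ at y i j ℚ.- at x i j ∣ ℚ.< ε)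

opaque
  -- With L the Lipschitz constant, (L + 1) ε is half of the gap `g`, so half of the gap survives
  -- the move. The 1 keeps the divisor positive for constant forms and leaves the strict surplus ε.
  evalℝ<0-open : ∀ (F : Form m) {x} → evalℝ F x <ℝ 0ℝ →
                 ∃[ ε ] (0ℚ ℚ.< ε × ∀ {y} → Close ε x y → evalℝ F y <ℝ 0ℝ)
  evalℝ<0-open F {x} (mk< g 0<g Fx<0)
    with fraction (lipschitz F ℚ.+ 1ℚ) (½ ℚ.* g)
           (ℚₚ.+-mono-≤-< (lipschitz-nonNeg F) (ℚₚ.positive⁻¹ 1ℚ)) (0<½* 0<g)
  ... | ε , 0<ε , Lε = ε , 0<ε , λ {y} close → mk< (½ ℚ.* g) (0<½* 0<g)
    (eventually-map (λ i (Fx , xy) → below y i Fx xy) (eventually-∧ Fx<0 (eventually-∀ close)))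
    where
    open +-*-Solver
    certificate : ∀ A B L ε h g → (L ℚ.+ 1ℚ) ℚ.* ε ≡ h → h ℚ.+ h ≡ g →
      B ℚ.+ h ℚ.+ (((0ℚ ℚ.- (A ℚ.+ g)) ℚ.+ ε) ℚ.+ ((A ℚ.+ L ℚ.* ε) ℚ.- B)) ≡ 0ℚ
    certificate A B L ε h g refl refl = solve 4 (λ A B L ε →
      B :+ (L :+ con 1ℚ) :* ε :+ (((con 0ℚ :- (A :+ ((L :+ con 1ℚ) :* ε :+ (L :+ con 1ℚ) :* ε)))
        :+ ε) :+ ((A :+ L :* ε) :- B)) := con 0ℚ) refl A B L ε
    below : ∀ y i → seq (evalℝ F x) i ℚ.+ g ℚ.< 0ℚ →
            (∀ j → ℚ.∣ at y i j ℚ.- at x i j ∣ ℚ.< ε) →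
            seq (evalℝ F y) i ℚ.+ ½ ℚ.* g ℚ.< 0ℚ
    below y i Fx xy rewrite seq-evalℝ F x i | seq-evalℝ F y i = 0<+⇒<
      (0<+0≤ (0<+0< (<⇒0< Fx) 0<ε)
             (≤⇒0≤ (eval-lipschitz F (at x i) (at y i) (λ j → ℚₚ.<⇒≤ (xy j)))))
      (certificate (eval F (at x i)) (eval F (at y i)) (lipschitz F) ε (½ ℚ.* g) g Lε (halves g))

  -- At one index the weights are only above - ε and their sum only within ε of 1. The errors add up
  -- to at most (a + b + ∣ κ ∣) ε, which is half of the gap.
  convex-bound : ∀ s t A B κ g h ε a b →
    0ℚ ℚ.< s ℚ.+ ε → 0ℚ ℚ.< t ℚ.+ ε → ℚ.∣ (s ℚ.+ t) ℚ.- 1ℚ ∣ ℚ.< ε → 0ℚ ℚ.< ε → 0ℚ ℚ.< g →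
    A ℚ.+ g ℚ.< 0ℚ → B ℚ.+ g ℚ.< 0ℚ → ℚ.∣ A ∣ ℚ.≤ a → ℚ.∣ B ∣ ℚ.≤ b →
    (a ℚ.+ b ℚ.+ ℚ.∣ κ ∣) ℚ.* ε ≡ h → h ℚ.+ h ≡ g →
    s ℚ.* A ℚ.+ t ℚ.* B ℚ.+ (1ℚ ℚ.- (s ℚ.+ t)) ℚ.* κ ℚ.+ h ℚ.< 0ℚ
  convex-bound s t A B κ g h ε a b 0<s 0<t st 0<ε 0<g A<0 B<0 A≤a B≤b refl refl = 0<+⇒<
    (0<+0≤ (0<+0≤ (0<+0≤ (0<+0≤ (0<+0< (0<+0< (0<*0< 0<s (<⇒0< A<0)) (0<*0< 0<t (<⇒0< B<0)))
      (0<*0< 0<ε 0<g))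
      (0≤*0≤ (≤⇒0≤ (ℚₚ.≤-trans (ℚₚ.neg-antimono-≤ (ℚₚ.<⇒≤ st)) (-∣p∣≤p _))) (ℚₚ.<⇒≤ 0<g)))
      (0≤*0≤ (ℚₚ.<⇒≤ 0<ε) (≤⇒0≤ (ℚₚ.≤-trans (ℚₚ.neg-antimono-≤ A≤a) (-∣p∣≤p A)))))
      (0≤*0≤ (ℚₚ.<⇒≤ 0<ε) (≤⇒0≤ (ℚₚ.≤-trans (ℚₚ.neg-antimono-≤ B≤b) (-∣p∣≤p B)))))
      (≤⇒0≤ (*≤∣∣* κ (1ℚ ℚ.- (s ℚ.+ t)) ε
        (ℚₚ.≤-trans (ℚₚ.≤-reflexive (∣p-q∣≡∣q-p∣ 1ℚ (s ℚ.+ t))) (ℚₚ.<⇒≤ st)))))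
    (certificate s t A B κ ℚ.∣ κ ∣ ε a b)
    where
    open +-*-Solver
    certificate : ∀ s t A B κ K ε a b → let h = (a ℚ.+ b ℚ.+ K) ℚ.* ε ; g = h ℚ.+ h in
      s ℚ.* A ℚ.+ t ℚ.* B ℚ.+ (1ℚ ℚ.- (s ℚ.+ t)) ℚ.* κ ℚ.+ h ℚ.+
      ((s ℚ.+ ε) ℚ.* (0ℚ ℚ.- (A ℚ.+ g)) ℚ.+ (t ℚ.+ ε) ℚ.* (0ℚ ℚ.- (B ℚ.+ g)) ℚ.+ ε ℚ.* g
        ℚ.+ ((s ℚ.+ t) ℚ.- 1ℚ ℚ.- (ℚ.- ε)) ℚ.* g
        ℚ.+ ε ℚ.* (A ℚ.- (ℚ.- a)) ℚ.+ ε ℚ.* (B ℚ.- (ℚ.- b))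
        ℚ.+ (K ℚ.* ε ℚ.- κ ℚ.* (1ℚ ℚ.- (s ℚ.+ t)))) ≡ 0ℚ
    certificate = solve 9 (λ s t A B κ K ε a b →
      let h = (a :+ b :+ K) :* ε ; g = h :+ h in
      s :* A :+ t :* B :+ (con 1ℚ :- (s :+ t)) :* κ :+ h :+
      ((s :+ ε) :* (con 0ℚ :- (A :+ g)) :+ (t :+ ε) :* (con 0ℚ :- (B :+ g)) :+ ε :* g
        :+ ((s :+ t) :- con 1ℚ :- (:- ε)) :* g
        :+ ε :* (A :- (:- a)) :+ ε :* (B :- (:- b))
        :+ (K :* ε :- κ :* (con 1ℚ :- (s :+ t)))) := con 0ℚ) refl

  evalℝ<0-convex : ∀ (F : Form m) {x y} → evalℝ F x <ℝ 0ℝ → evalℝ F y <ℝ 0ℝ →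
    ∀ s t → 0ℝ ≤ℝ s → 0ℝ ≤ℝ t → s +ℝ t ≈ℝ 1ℝ →
    evalℝ F (λ i → s *ℝ x i +ℝ t *ℝ y i) <ℝ 0ℝ
  evalℝ<0-convex {m} F {x} {y} (mk< g₁ 0<g₁ Fx<0) (mk< g₂ 0<g₂ Fy<0) s t (mk≤ 0≤s) (mk≤ 0≤t) (mk≈ s+t)
    with cauchy-bound (seq (evalℝ F x)) (cauchy (evalℝ F x))
       | cauchy-bound (seq (evalℝ F y)) (cauchy (evalℝ F y))
       | positive-lower-bound 0<g₁ 0<g₂
  ... | a , 0<a , Fx≤a | b , 0<b , Fy≤b | g , 0<g , g≤g₁ , g≤g₂
    with fraction (a ℚ.+ b ℚ.+ ℚ.∣ constant F ∣) (½ ℚ.* g)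
           (0<+0≤ (0<+0< 0<a 0<b) (ℚₚ.0≤∣p∣ (constant F))) (0<½* 0<g)
  ... | ε , 0<ε , eq = mk< (½ ℚ.* g) (0<½* 0<g)
    (eventually-map (λ i (((A , B) , (A≤a , B≤b)) , (0<s , 0<t) , st) → below i A B A≤a B≤b 0<s 0<t st)
      (eventually-∧ (eventually-∧ (eventually-∧ Fx<0 Fy<0) (eventually-∧ Fx≤a Fy≤b))
        (eventually-∧ (eventually-∧ (0≤s ε 0<ε) (0≤t ε 0<ε)) (s+t ε 0<ε))))
    where
    combination : ℝ^ m
    combination j = s *ℝ x j +ℝ t *ℝ y j
    below : ∀ i → seq (evalℝ F x) i ℚ.+ g₁ ℚ.< 0ℚ → seq (evalℝ F y) i ℚ.+ g₂ ℚ.< 0ℚ →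
            ℚ.∣ seq (evalℝ F x) i ∣ ℚ.≤ a → ℚ.∣ seq (evalℝ F y) i ∣ ℚ.≤ b →
            0ℚ ℚ.< seq s i ℚ.+ ε → 0ℚ ℚ.< seq t i ℚ.+ ε →
            ℚ.∣ (seq s i ℚ.+ seq t i) ℚ.- 1ℚ ∣ ℚ.< ε →
            seq (evalℝ F combination) i ℚ.+ ½ ℚ.* g ℚ.< 0ℚ
    below i A B A≤a B≤b 0<s 0<t st
      rewrite seq-evalℝ F combination i | eval-combination F (seq s i) (seq t i) (at x i) (at y i)
            | seq-evalℝ F x i | seq-evalℝ F y i =
      convex-bound (seq s i) (seq t i) (eval F (at x i)) (eval F (at y i)) (constant F)
        g (½ ℚ.* g) ε a b 0<s 0<t st 0<ε 0<g
        (ℚₚ.≤-<-trans (ℚₚ.+-monoʳ-≤ (eval F (at x i)) g≤g₁) A)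
        (ℚₚ.≤-<-trans (ℚₚ.+-monoʳ-≤ (eval F (at y i)) g≤g₂) B) A≤a B≤b eq (halves g)

-- Coordinate functionals, rational points and common radii

unit : Fin m → ℝ^ m
unit zero    zero    = 1ℝ
unit zero    (suc k) = 0ℝ
unit (suc j) zero    = 0ℝ
unit (suc j) (suc k) = unit j k

opaque
  ½<1 : 0ℚ ℚ.+ ½ ℚ.< 1ℚ
  ½<1 = from-yes ((0ℚ ℚ.+ ½) ℚₚ.<? 1ℚ)

unit-nonzero : ∀ (j : Fin m) → 0ℝ <ℝ unit j j
unit-nonzero zero    = mk< ½ (ℚₚ.positive⁻¹ ½) (0 , λ _ _ → ½<1)
unit-nonzero (suc j) = unit-nonzero j

opaque
  seq-∑-zero : ∀ (x : ℝ^ m) i → seq (∑ℝ (λ k → 0ℝ *ℝ x k)) i ≡ 0ℚ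
  seq-∑-zero {zero}  x i = refl
  seq-∑-zero {suc m} x i = trans
    (cong₂ ℚ._+_ (ℚₚ.*-zeroˡ (seq (x zero) i)) (seq-∑-zero (x ∘ suc) i)) (ℚₚ.+-identityˡ 0ℚ)

  seq-unit-· : ∀ (j : Fin m) x i → seq (unit j · x) i ≡ at x i j
  seq-unit-· zero    x i = trans
    (cong₂ ℚ._+_ (ℚₚ.*-identityˡ (seq (x zero) i)) (seq-∑-zero (x ∘ suc) i)) (ℚₚ.+-identityʳ _)
  seq-unit-· (suc j) x i = trans
    (cong₂ ℚ._+_ (ℚₚ.*-zeroˡ (seq (x zero) i)) (seq-unit-· j (x ∘ suc) i)) (ℚₚ.+-identityˡ _)

  <⇒seq< : ∀ {x y : ℝ} → x <ℝ y → Eventually (λ i → seq x i ℚ.< seq y i)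
  <⇒seq< {x} (mk< g 0<g x<y) = eventually-map
    (λ i → ℚₚ.≤-<-trans (0≤+⇒≤ (ℚₚ.<⇒≤ 0<g) refl)) x<y

  seq<⇒< : ∀ {x y : ℝ} → p ℚ.< q → (∀ i → seq x i ≡ p) → (∀ i → seq y i ≡ q) → x <ℝ y
  seq<⇒< {p} {q} p<q x≡p y≡q = mk< (½ ℚ.* (q ℚ.- p)) (0<½* (<⇒0< p<q))
    (0 , λ i _ → subst₂ ℚ._<_ (cong (ℚ._+ _) (sym (x≡p i))) (sym (y≡q i)) halfway)
    where
    halfway : p ℚ.+ ½ ℚ.* (q ℚ.- p) ℚ.< q
    halfway = 0<+⇒< (0<½* (<⇒0< p<q)) (trans
      (ℚₚ.+-assoc p _ _) (trans (cong (p ℚ.+_) (halves (q ℚ.- p))) (cancel p q)))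
      where
      open +-*-Solver
      cancel : ∀ p q → p ℚ.+ (q ℚ.- p) ≡ q
      cancel = solve 2 (λ p q → p :+ (q :- p) := q) refl

  uniformly : ∀ {Q : Subset n → Pred ℚ 0ℓ} →
              (∀ X {δ ε} → δ ℚ.≤ ε → Q X ε → Q X δ) →
              (∀ X → ∃[ ε ] (0ℚ ℚ.< ε × Q X ε)) → ∃[ ε ] (0ℚ ℚ.< ε × (∀ X → Q X ε))
  uniformly {zero}  mono each with each []
  ... | ε , 0<ε , q = ε , 0<ε , λ { [] → q }
  uniformly {suc n} mono each
    with uniformly (λ X → mono (inside ∷ X)) (λ X → each (inside ∷ X))
       | uniformly (λ X → mono (outside ∷ X)) (λ X → each (outside ∷ X))
  ... | δ , 0<δ , ins | ε , 0<ε , outs with positive-lower-bound 0<δ 0<ε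
  ...   | η , 0<η , η≤δ , η≤ε = η , 0<η , λ
    { (inside ∷ X)  → mono (inside ∷ X) η≤δ (ins X)
    ; (outside ∷ X) → mono (outside ∷ X) η≤ε (outs X) }

-- A realization from axis-parallel hyperplanes and separating half-spaces

module Arrangement {𝒞 : SetSystem n} (c : Fin n → Fin m) (b : Fin n → ℚ)
                   (point : Subset n → Fin m → ℚ) where

  InCell : Subset n → Pred (Fin m → ℚ) 0ℓ
  InCell X z = (∀ e → e ∈ X → b e ℚ.< z (c e)) × (∀ e → e ∉ X → z (c e) ℚ.< b e)

  -- The bound is weak on the cell and strict at the points: the open half-space where the form is
  -- negative then misses the whole cell and keeps every chosen point.
  record Separator (X : Subset n) : Set where
    field
      form              : Form m
      cell-nonneg       : ∀ z → InCell X z → 0ℚ ℚ.≤ eval form z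
      point-negative    : ∀ Y → 𝒞 Y → eval form (point Y) ℚ.< 0ℚ

  open Separator

  module _ (separate : ∀ X → 𝒞 X ⊎ Separator X)
           (point-inCell : ∀ Y → 𝒞 Y → InCell Y (point Y)) where

    Avoids : ∀ X → 𝒞 X ⊎ Separator X → Pred (ℝ^ m) 0ℓ
    Avoids X (inj₁ _) x = Unit.⊤
    Avoids X (inj₂ s) x = evalℝ (form s) x <ℝ 0ℝ

    Region : Pred (ℝ^ m) 0ℓ
    Region x = ∀ X → Avoids X (separate X) x

    avoids-open : ∀ X s {x} → Avoids X s x →
                  ∃[ ε ] (0ℚ ℚ.< ε × (∀ y → Close ε x y → Avoids X s y))
    avoids-open X (inj₁ _) _  = 1ℚ , ℚₚ.positive⁻¹ 1ℚ , λ _ _ → Unit.tt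
    avoids-open X (inj₂ s) ax with evalℝ<0-open (form s) ax
    ... | ε , 0<ε , near = ε , 0<ε , λ _ → near

    region-nbhd : ∀ {x} → Region x →
                  ∃[ ε ] (0ℚ ℚ.< ε × (∀ X y → Close ε x y → Avoids X (separate X) y))
    region-nbhd {x} x∈ = uniformly
      (λ X δ≤ε near y close → near y λ j →
        eventually-map (λ i h → ℚₚ.<-≤-trans h δ≤ε) (close j))
      (λ X → avoids-open X (separate X) (x∈ X))

    region-respects : Respects≈ Region
    region-respects {x} {y} x≈y x∈ X with region-nbhd x∈
    ... | ε , 0<ε , near = near X y λ j → let mk≈ close = x≈y j in
      eventually-map (λ i → subst (ℚ._< ε) (∣p-q∣≡∣q-p∣ (at x i j) (at y i j))) (close ε 0<ε)

    avoids-convex : ∀ X s {x y} → Avoids X s x → Avoids X s y →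
      ∀ λ₁ λ₂ → 0ℝ ≤ℝ λ₁ → 0ℝ ≤ℝ λ₂ → λ₁ +ℝ λ₂ ≈ℝ 1ℝ →
      Avoids X s (λ i → λ₁ *ℝ x i +ℝ λ₂ *ℝ y i)
    avoids-convex X (inj₁ _) _  _  = λ _ _ _ _ _ → Unit.tt
    avoids-convex X (inj₂ s) ax ay = evalℝ<0-convex (form s) ax ay

    region-open : RelativelyOpen Region
    region-open {x} x∈ with region-nbhd x∈
    ... | ε , 0<ε , near = fromℚ ε
      , seq<⇒< 0<ε (λ _ → refl) (λ _ → refl)
      , λ {y} _ box X → near X y λ j →
          eventually-map (λ i (lo , hi) → within (seq (x j) i) (seq (y j) i) lo hi)
            (eventually-∧ (<⇒seq< (proj₁ (box j))) (<⇒seq< (proj₂ (box j))))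
      where
      within : ∀ a b → a ℚ.- ε ℚ.< b → b ℚ.< a ℚ.+ ε → ℚ.∣ b ℚ.- a ∣ ℚ.< ε
      within a b lo hi = ∣∣<⁺ b a (0<+⇒< (<⇒0< hi) (above a b ε)) (0<+⇒< (<⇒0< lo) (below a b ε))
        where
        open +-*-Solver
        above : ∀ a b ε → b ℚ.- a ℚ.+ (a ℚ.+ ε ℚ.- b) ≡ ε
        above = solve 3 (λ a b ε → b :- a :+ (a :+ ε :- b) := ε) refl
        below : ∀ a b ε → a ℚ.- b ℚ.+ (b ℚ.- (a ℚ.- ε)) ≡ ε
        below = solve 3 (λ a b ε → a :- b :+ (b :- (a :- ε)) := ε) refl

    hyperplane : Fin n → OrientedHyperplane m
    hyperplane e = record
      { normal         = unit (c e)
      ; offset         = fromℚ (b e)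
      ; normal-nonzero = c e , inj₂ (unit-nonzero (c e))
      }

    RealCell : Subset n → Pred (ℝ^ m) 0ℓ
    RealCell X x = (∀ e → e ∈ X → PositiveSide (hyperplane e) x) ×
                   (∀ e → e ∉ X → NegativeSide (hyperplane e) x)

    realCell⇒inCell : ∀ {X x} → RealCell X x → Eventually (λ i → InCell X (at x i))
    realCell⇒inCell {X} {x} (pos , neg) =
      eventually-map (λ i side → (λ e → proj₁ (side e)) , (λ e → proj₂ (side e)))
        (eventually-∀ λ e → side e (e Subₚ.∈? X))
      where
      side : ∀ e → Dec (e ∈ X) →
             Eventually (λ i → (e ∈ X → b e ℚ.< at x i (c e)) × (e ∉ X → at x i (c e) ℚ.< b e))
      side e (yes e∈X) = eventually-map
        (λ i h → (λ _ → subst (b e ℚ.<_) (seq-unit-· (c e) x i) h) , (λ e∉X → contradiction e∈X e∉X))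
        (<⇒seq< (pos e e∈X))
      side e (no e∉X) = eventually-map
        (λ i h → (λ e∈X → contradiction e∈X e∉X) , (λ _ → subst (ℚ._< b e) (seq-unit-· (c e) x i) h))
        (<⇒seq< (neg e e∉X))

    realPoint : Subset n → ℝ^ m
    realPoint Y j = fromℚ (point Y j)

    realPoint-cell : ∀ Y → 𝒞 Y → RealCell Y (realPoint Y)
    realPoint-cell Y 𝒞Y =
        (λ e e∈Y → seq<⇒< (proj₁ (point-inCell Y 𝒞Y) e e∈Y)
          (λ _ → refl) (seq-unit-· (c e) (realPoint Y)))
      , (λ e e∉Y → seq<⇒< (proj₂ (point-inCell Y 𝒞Y) e e∉Y)
          (seq-unit-· (c e) (realPoint Y)) (λ _ → refl))

    realPoint-region : ∀ Y → 𝒞 Y → Region (realPoint Y)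
    realPoint-region Y 𝒞Y X = avoids (separate X)
      where
      avoids : ∀ s → Avoids X s (realPoint Y)
      avoids (inj₁ _) = Unit.tt
      avoids (inj₂ s) = seq<⇒< (point-negative s Y 𝒞Y)
        (seq-evalℝ (form s) (realPoint Y)) (λ _ → refl)

    -- For a non-member, both strict conditions hold at one late index, which would give a rational
    -- point of the cell with a negative value of the form.
    region-cell⇒member : ∀ X {x} → Region x → RealCell X x → 𝒞 X
    region-cell⇒member X {x} x∈ cell = decide (separate X) (x∈ X)
      where
      decide : ∀ s → Avoids X s x → 𝒞 X
      decide (inj₁ 𝒞X) _ = 𝒞X
      decide (inj₂ s)  avoids
        with eventually-∧ (<⇒seq< avoids) (realCell⇒inCell cell)
      ... | N , at≥ with at≥ N ℕₚ.≤-refl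
      ...   | F<0 , inCell = contradiction
        (subst (ℚ._< 0ℚ) (seq-evalℝ (form s) x N) F<0)
        (λ F<0 → ℚₚ.<-irrefl refl (ℚₚ.≤-<-trans (cell-nonneg s (at x N) inCell) F<0))

    realization : Realization 𝒞 m
    realization = record
      { hyperplane      = hyperplane
      ; region          = Region
      ; region-respects = region-respects
      ; region-convex   = λ x∈ y∈ s t 0≤s 0≤t s+t X →
          avoids-convex X (separate X) (x∈ X) (y∈ X) s t 0≤s 0≤t s+t
      ; region-open     = region-open
      ; cells           = λ X → mk⇔
          (λ 𝒞X → realPoint X , realPoint-region X 𝒞X , realPoint-cell X 𝒞X)
          (λ (x , x∈ , cell) → region-cell⇒member X x∈ cell)
      }

-- The sequence level 0, threshold 0, level 1, threshold 1, … decreases, and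
-- threshold k / level k = δ * level k.  The hyperplane of an element of rank k
-- sits at - threshold k, and chosen points have coordinates - level k.
module Levels (δ : ℚ) (0<δ : 0ℚ ℚ.< δ) (2δ≤1 : δ ℚ.+ δ ℚ.≤ 1ℚ) where

  opaque
    level : ℕ → ℚ
    threshold : ℕ → ℚ
    level zero    = 1ℚ
    level (suc k) = ½ ℚ.* threshold k
    threshold k = δ ℚ.* (level k ℚ.* level k)

    threshold-def : ∀ k → threshold k ≡ δ ℚ.* (level k ℚ.* level k)
    threshold-def k = refl

    level>0 : ∀ k → 0ℚ ℚ.< level k
    threshold>0 : ∀ k → 0ℚ ℚ.< threshold k
    level>0 zero    = ℚₚ.positive⁻¹ 1ℚ
    level>0 (suc k) = 0<½* (threshold>0 k)
    threshold>0 k = 0<*0< 0<δ (0<*0< (level>0 k) (level>0 k))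

    2threshold≤level² : ∀ k → threshold k ℚ.+ threshold k ℚ.≤ level k ℚ.* level k
    2threshold≤level² k = 0≤+⇒≤
      (0≤*0≤ (≤⇒0≤ 2δ≤1) (ℚₚ.<⇒≤ (0<*0< (level>0 k) (level>0 k))))
      (certificate δ (level k ℚ.* level k))
      where
      open +-*-Solver
      certificate : ∀ δ s → δ ℚ.* s ℚ.+ δ ℚ.* s ℚ.+ (1ℚ ℚ.- (δ ℚ.+ δ)) ℚ.* s ≡ s
      certificate = solve 2 (λ δ s → δ :* s :+ δ :* s :+ (con 1ℚ :- (δ :+ δ)) :* s := s) refl

    level+level : ∀ k → level (suc k) ℚ.+ level (suc k) ≡ threshold k
    level+level k = halves (threshold k)

    next-level<threshold : ∀ k → level (suc k) ℚ.< threshold k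
    next-level<threshold k = 0<+⇒< (level>0 (suc k)) (level+level k)

    level≤1 : ∀ k → level k ℚ.≤ 1ℚ
    level²≤level : ∀ k → level k ℚ.* level k ℚ.≤ level k
    threshold<level : ∀ k → threshold k ℚ.< level k
    level≤1 zero    = ℚₚ.≤-refl
    level≤1 (suc k) = ℚₚ.≤-trans (ℚₚ.<⇒≤ (next-level<threshold k))
      (ℚₚ.≤-trans (ℚₚ.<⇒≤ (threshold<level k)) (level≤1 k))
    level²≤level k = 0≤+⇒≤ (0≤*0≤ (ℚₚ.<⇒≤ (level>0 k)) (≤⇒0≤ (level≤1 k)))
      (certificate (level k))
      where
      open +-*-Solver
      certificate : ∀ ρ → ρ ℚ.* ρ ℚ.+ ρ ℚ.* (1ℚ ℚ.- ρ) ≡ ρ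
      certificate = solve 1 (λ ρ → ρ :* ρ :+ ρ :* (con 1ℚ :- ρ) := ρ) refl
    threshold<level k = ℚₚ.<-≤-trans (0<+⇒< (threshold>0 k) refl)
      (ℚₚ.≤-trans (2threshold≤level² k) (level²≤level k))

    level-antitone : ∀ {j k} → j ℕ.≤ k → level k ℚ.≤ level j
    level-antitone {j} {k} j≤k = go (ℕₚ.≤⇒≤′ j≤k)
      where
      go : ∀ {k} → j ℕ.≤′ k → level k ℚ.≤ level j
      go ℕ.≤′-refl              = ℚₚ.≤-refl
      go (ℕ.≤′-step {n = k} j≤k) = ℚₚ.≤-trans
        (ℚₚ.<⇒≤ (ℚₚ.<-trans (next-level<threshold k) (threshold<level k))) (go j≤k)

-- Chosen points of members and half-spaces excluding non-members

ones : {A : Set} → List A → ℚ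
ones []      = 0ℚ
ones (_ ∷ l) = 1ℚ ℚ.+ ones l

term : (Fin m → ℚ) → ℚ × ℚ × Fin m → ℚ
term z (w , β , j) = w ℚ.* z j ℚ.+ β

module _ (t : Fin n → ℚ × ℚ × Fin m) (z : Fin m → ℚ) where
  opaque
    eval-nonNeg : (∀ e → 0ℚ ℚ.≤ term z (t e)) → ∀ l → 0ℚ ℚ.≤ eval (map t l) z
    eval-nonNeg 0≤ []      = ℚₚ.≤-refl
    eval-nonNeg 0≤ (e ∷ l) = 0≤+0≤ (0≤ e) (eval-nonNeg 0≤ l)

    eval≤ones : (∀ e → term z (t e) ℚ.≤ 1ℚ) → ∀ l → eval (map t l) z ℚ.≤ ones l
    eval≤ones ≤1 []      = ℚₚ.≤-refl
    eval≤ones ≤1 (e ∷ l) = ℚₚ.+-mono-≤ (≤1 e) (eval≤ones ≤1 l)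

    -- Replacing one summand bound 1 by - K lowers the total bound to `ones l` - 1 - K; the lost 1
    -- makes the inequality strict.
    eval<ones : ∀ {e₀ K} → (∀ e → term z (t e) ℚ.≤ 1ℚ) → term z (t e₀) ℚ.≤ ℚ.- K →
                ∀ {l} → e₀ List.∈ l → eval (map t l) z ℚ.< ones l ℚ.- K
    eval<ones {e₀} {K} ≤1 ≤-K {_ ∷ l} (here refl) = 0<+⇒<
      (0<+0≤ (0<+0≤ (ℚₚ.positive⁻¹ 1ℚ) (≤⇒0≤ ≤-K)) (≤⇒0≤ (eval≤ones ≤1 l)))
      (certificate (term z (t e₀)) (eval (map t l) z) (ones l) K)
      where
      open +-*-Solver
      certificate : ∀ a b o K →
        a ℚ.+ b ℚ.+ (1ℚ ℚ.+ (ℚ.- K ℚ.- a) ℚ.+ (o ℚ.- b)) ≡ 1ℚ ℚ.+ o ℚ.- K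
      certificate = solve 4 (λ a b o K →
        a :+ b :+ (con 1ℚ :+ (:- K :- a) :+ (o :- b)) := con 1ℚ :+ o :- K) refl
    eval<ones {K = K} ≤1 ≤-K {e ∷ l} (there e₀∈l) =
      subst (_ ℚ.<_) (sym (ℚₚ.+-assoc 1ℚ (ones l) (ℚ.- K)))
        (ℚₚ.+-mono-≤-< (≤1 e) (eval<ones ≤1 ≤-K e₀∈l))

opaque
  ones-nonNeg : {A : Set} (l : List A) → 0ℚ ℚ.≤ ones l
  ones-nonNeg []      = ℚₚ.≤-refl
  ones-nonNeg (_ ∷ l) = 0≤+0≤ (ℚₚ.<⇒≤ (ℚₚ.positive⁻¹ 1ℚ)) (ones-nonNeg l)

module ChainRealization {n m} {𝒞 : SetSystem n} (𝒞? : Decidable 𝒞) (sys : IsDownsetSystem 𝒞)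
  (covers : Covers 𝒞) (c : Fin n → Fin m)
  (c-chain : ∀ e f → c e ≡ c f → Precedes 𝒞 e f ⊎ Precedes 𝒞 f e) where

  open DownsetSystem 𝒞? sys covers

  -- `κ` is n as a rational, and δ will be 1 / `D`. The 2 in `D` ensures 2 δ ≤ 1 and also 1 - `D` ≤
  -- - `κ`, the bound on the decisive summand in `BoundSeparator`.
  D κ : ℚ
  κ = ones (allFin n)
  D = κ ℚ.+ (1ℚ ℚ.+ 1ℚ)

  opaque
    scale : ∃[ δ ] (0ℚ ℚ.< δ × D ℚ.* δ ≡ 1ℚ)
    scale = fraction D 1ℚ (ℚₚ.+-mono-≤-< (ones-nonNeg (allFin n)) (ℚₚ.positive⁻¹ (1ℚ ℚ.+ 1ℚ)))
                     (ℚₚ.positive⁻¹ 1ℚ)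

  δ : ℚ
  δ = proj₁ scale

  opaque
    2δ≤1 : δ ℚ.+ δ ℚ.≤ 1ℚ
    2δ≤1 = 0≤+⇒≤ (0≤*0≤ (ones-nonNeg (allFin n)) (ℚₚ.<⇒≤ (proj₁ (proj₂ scale))))
      (trans (certificate κ δ) (proj₂ (proj₂ scale)))
      where
      open +-*-Solver
      certificate : ∀ κ δ → δ ℚ.+ δ ℚ.+ κ ℚ.* δ ≡ (κ ℚ.+ (1ℚ ℚ.+ 1ℚ)) ℚ.* δ
      certificate = solve 2 (λ κ δ →
        δ :+ δ :+ κ :* δ := (κ :+ (con 1ℚ :+ con 1ℚ)) :* δ) refl

  open Levels δ (proj₁ (proj₂ scale)) 2δ≤1

  opaque
    -- One more than the largest rank of an element of `Y` on axis `j`, and 0 if there is none: the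
    -- first level past all thresholds of `Y` on that axis.
    height : Subset n → Fin m → ℕ
    height Y j = max 0 (map (suc ∘ rank) (filter (λ e → (e Subₚ.∈? Y) ×-dec (c e Finₚ.≟ j)) (allFin n)))

    height-∈ : ∀ {Y e} → e ∈ Y → rank e ℕ.< height Y (c e)
    height-∈ {Y} {e} e∈Y = v≤max⁺ 0 _ (inj₂ (Any.map ℕₚ.≤-reflexive
      (List.∈-map⁺ (suc ∘ rank) (List.∈-filter⁺ _ (List.∈-allFin e) (e∈Y , refl)))))

    -- Elements of `Y` on the axis of `e` are comparable with `e` but not above it, since `Y` is a
    -- downset. Their ranks are thus strictly smaller, which pays for the `suc` in `height`.
    height-∉ : ∀ {Y e} → 𝒞 Y → e ∉ Y → height Y (c e) ℕ.≤ rank e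
    height-∉ {Y} {e} 𝒞Y e∉Y = max≤v⁺ z≤n (All.tabulate below)
      where
      below : ∀ {h} → h List.∈ map (suc ∘ rank)
                (filter (λ f → (f Subₚ.∈? Y) ×-dec (c f Finₚ.≟ c e)) (allFin n)) → h ℕ.≤ rank e
      below h∈ with List.∈-map⁻ (suc ∘ rank) h∈
      ... | f , f∈ , refl
        with List.∈-filter⁻ (λ f → (f Subₚ.∈? Y) ×-dec (c f Finₚ.≟ c e)) {xs = allFin n} f∈
      ...   | _ , f∈Y , cf≡ce with c-chain f e cf≡ce
      ...     | inj₁ f≼e = rank-mono-< f≼e λ { refl → e∉Y f∈Y }
      ...     | inj₂ e≼f = contradiction (e≼f Y 𝒞Y f∈Y) e∉Y

  bound : Fin n → ℚ
  bound e = ℚ.- threshold (rank e)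

  point : Subset n → Fin m → ℚ
  point Y j = ℚ.- level (height Y j)

  open Arrangement {𝒞 = 𝒞} c bound point

  point-inCell : ∀ Y → 𝒞 Y → InCell Y (point Y)
  point-inCell Y 𝒞Y =
      (λ e e∈Y → ℚₚ.neg-antimono-< (ℚₚ.≤-<-trans (level-antitone (height-∈ e∈Y))
                                                  (next-level<threshold (rank e))))
    , (λ e e∉Y → ℚₚ.neg-antimono-< (ℚₚ.<-≤-trans (threshold<level (rank e))
                                                  (level-antitone (height-∉ 𝒞Y e∉Y))))

  -- The half-space is 2 (z_e + τ_e) < ρ (z_f + τ_f).  At a point of Y with
  -- e ∉ Y we have z_e ≤ - ρ, so the left is at most ρ² - 2 ρ ≤ - ρ; with e, f ∈ Y
  -- it is below 2 τ_e ≤ ρ², while z_f + τ_f ≥ level (1 + rank f) ≥ ρ.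
  module OrderSeparator {X e f} (f≼e : f ≼ e) (e∈X : e ∈ X) (f∉X : f ∉ X) where
    ρ : ℚ
    ρ = level (rank e)

    orderForm : Form m
    orderForm = (1ℚ ℚ.+ 1ℚ , threshold (rank e) ℚ.+ threshold (rank e) , c e)
              ∷ (ℚ.- ρ , ℚ.- ρ ℚ.* threshold (rank f) , c f) ∷ []

    rank-f<rank-e : rank f ℕ.< rank e
    rank-f<rank-e = rank-mono-< f≼e λ { refl → f∉X e∈X }

    opaque
      cell-nonneg : ∀ z → InCell X z → 0ℚ ℚ.≤ eval orderForm z
      cell-nonneg z (above , below) = ℚₚ.≤-trans
        (0≤+0≤ (0≤+0≤ u≥ u≥) (0≤*0≤ (ℚₚ.<⇒≤ (level>0 (rank e))) (≤⇒0≤ (ℚₚ.<⇒≤ (below f f∉X)))))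
        (ℚₚ.≤-reflexive (certificate ρ (threshold (rank e)) (threshold (rank f)) (z (c e)) (z (c f))))
        where
        open +-*-Solver
        u≥ : 0ℚ ℚ.≤ z (c e) ℚ.- bound e
        u≥ = ≤⇒0≤ (ℚₚ.<⇒≤ (above e e∈X))
        certificate : ∀ ρ τ σ u v →
          (u ℚ.- (ℚ.- τ)) ℚ.+ (u ℚ.- (ℚ.- τ)) ℚ.+ ρ ℚ.* (ℚ.- σ ℚ.- v) ≡
          ((1ℚ ℚ.+ 1ℚ) ℚ.* u ℚ.+ (τ ℚ.+ τ)) ℚ.+ ((ℚ.- ρ ℚ.* v ℚ.+ ℚ.- ρ ℚ.* σ) ℚ.+ 0ℚ)
        certificate = solve 5 (λ ρ τ σ u v →
          (u :- (:- τ)) :+ (u :- (:- τ)) :+ ρ :* (:- σ :- v) :=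
          ((con 1ℚ :+ con 1ℚ) :* u :+ (τ :+ τ)) :+ ((:- ρ :* v :+ :- ρ :* σ) :+ con 0ℚ)) refl

      point-negative : ∀ Y → 𝒞 Y → eval orderForm (point Y) ℚ.< 0ℚ
      point-negative Y 𝒞Y with e Subₚ.∈? Y
      ... | yes e∈Y = 0<+⇒<
        (0<+0≤ (0<+0≤ (0<+0≤ (0<+0< 0<u 0<u)
          (≤⇒0≤ (2threshold≤level² (rank e))))
          (0≤*0≤ 0≤ρ (≤⇒0≤ (level-antitone rank-f<rank-e))))
          (0≤*0≤ 0≤ρ (≤⇒0≤ (level-antitone (height-∈ (f≼e Y 𝒞Y e∈Y))))))
        (certificate ρ (threshold (rank e)) (threshold (rank f)) (level (suc (rank f)))
          (level (height Y (c e))) (level (height Y (c f))) (level+level (rank f)))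
        where
        open +-*-Solver
        0≤ρ : 0ℚ ℚ.≤ ρ
        0≤ρ = ℚₚ.<⇒≤ (level>0 (rank e))
        0<u : 0ℚ ℚ.< level (height Y (c e))
        0<u = level>0 (height Y (c e))
        certificate : ∀ ρ τ σ R u v → R ℚ.+ R ≡ σ →
          ((1ℚ ℚ.+ 1ℚ) ℚ.* (ℚ.- u) ℚ.+ (τ ℚ.+ τ)) ℚ.+ ((ℚ.- ρ ℚ.* (ℚ.- v) ℚ.+ ℚ.- ρ ℚ.* σ) ℚ.+ 0ℚ)
          ℚ.+ (u ℚ.+ u ℚ.+ (ρ ℚ.* ρ ℚ.- (τ ℚ.+ τ)) ℚ.+ ρ ℚ.* (R ℚ.- ρ) ℚ.+ ρ ℚ.* (R ℚ.- v)) ≡ 0ℚ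
        certificate ρ τ σ R u v refl = solve 5 (λ ρ τ R u v →
          ((con 1ℚ :+ con 1ℚ) :* (:- u) :+ (τ :+ τ)) :+ ((:- ρ :* (:- v) :+ :- ρ :* (R :+ R)) :+ con 0ℚ)
          :+ (u :+ u :+ (ρ :* ρ :- (τ :+ τ)) :+ ρ :* (R :- ρ) :+ ρ :* (R :- v)) := con 0ℚ)
          refl ρ τ R u v
      ... | no e∉Y = 0<+⇒<
        (0<+0≤ (0<+0≤ (0<+0≤ (0<+0≤ (0<+0≤ (0<*0< 0<ρ (threshold>0 (rank f)))
          ρ≤u) ρ≤u)
          (≤⇒0≤ (2threshold≤level² (rank e))))
          (≤⇒0≤ (level²≤level (rank e))))
          (0≤*0≤ (ℚₚ.<⇒≤ 0<ρ) (≤⇒0≤ (level≤1 (height Y (c f))))))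
        (certificate ρ (threshold (rank e)) (threshold (rank f))
          (level (height Y (c e))) (level (height Y (c f))))
        where
        open +-*-Solver
        0<ρ : 0ℚ ℚ.< ρ
        0<ρ = level>0 (rank e)
        ρ≤u : 0ℚ ℚ.≤ level (height Y (c e)) ℚ.- ρ
        ρ≤u = ≤⇒0≤ (level-antitone (height-∉ 𝒞Y e∉Y))
        certificate : ∀ ρ τ σ u v →
          ((1ℚ ℚ.+ 1ℚ) ℚ.* (ℚ.- u) ℚ.+ (τ ℚ.+ τ)) ℚ.+ ((ℚ.- ρ ℚ.* (ℚ.- v) ℚ.+ ℚ.- ρ ℚ.* σ) ℚ.+ 0ℚ)
          ℚ.+ (ρ ℚ.* σ ℚ.+ (u ℚ.- ρ) ℚ.+ (u ℚ.- ρ) ℚ.+ (ρ ℚ.* ρ ℚ.- (τ ℚ.+ τ)) ℚ.+ (ρ ℚ.- ρ ℚ.* ρ)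
            ℚ.+ ρ ℚ.* (1ℚ ℚ.- v)) ≡ 0ℚ
        certificate = solve 5 (λ ρ τ σ u v →
          ((con 1ℚ :+ con 1ℚ) :* (:- u) :+ (τ :+ τ)) :+ ((:- ρ :* (:- v) :+ :- ρ :* σ) :+ con 0ℚ)
          :+ (ρ :* σ :+ (u :- ρ) :+ (u :- ρ) :+ (ρ :* ρ :- (τ :+ τ)) :+ (ρ :- ρ :* ρ)
            :+ ρ :* (con 1ℚ :- v)) := con 0ℚ) refl

    separator : Separator X
    separator = record
      { form = orderForm ; cell-nonneg = cell-nonneg ; point-negative = point-negative }

  -- The half-space is ∑_{e ∈ X} (z_e / τ_e + 1) < 0.  At a point of a member Y
  -- no summand exceeds 1, and one with e ∉ Y is at most - n.
  module BoundSeparator {X} (unbounded : ∀ Z → 𝒞 Z → ¬ X ⊆ Z) where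
    opaque
      reciprocal : ∀ k → ∃[ w ] (0ℚ ℚ.< w × threshold k ℚ.* w ≡ 1ℚ)
      reciprocal k = fraction (threshold k) 1ℚ (threshold>0 k) (ℚₚ.positive⁻¹ 1ℚ)

    weight : Fin n → ℚ
    weight e = proj₁ (reciprocal (rank e))

    0≤weight : ∀ e → 0ℚ ℚ.≤ weight e
    0≤weight e = ℚₚ.<⇒≤ (proj₁ (proj₂ (reciprocal (rank e))))

    -- Zero terms outside `X` let the sum run over all of `allFin n`, so that one count `κ` serves
    -- every `X`.
    summand : Fin n → ℚ × ℚ × Fin m
    summand e with e Subₚ.∈? X
    ... | yes _ = weight e , 1ℚ , c e
    ... | no  _ = 0ℚ , 0ℚ , c e

    opaque
      term-zero : ∀ (z : Fin m → ℚ) j → term z (0ℚ , 0ℚ , j) ≡ 0ℚ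
      term-zero z j = trans (ℚₚ.+-identityʳ _) (ℚₚ.*-zeroˡ (z j))

      cell-nonneg : ∀ z → InCell X z → 0ℚ ℚ.≤ eval (map summand (allFin n)) z
      cell-nonneg z (above , _) = eval-nonNeg summand z nonNeg (allFin n)
        where
        open +-*-Solver
        certificate : ∀ w τ u → τ ℚ.* w ≡ 1ℚ → w ℚ.* (u ℚ.- (ℚ.- τ)) ≡ w ℚ.* u ℚ.+ 1ℚ
        certificate w τ u eq = trans
          (solve 3 (λ w τ u → w :* (u :- (:- τ)) := w :* u :+ τ :* w) refl w τ u)
          (cong (w ℚ.* u ℚ.+_) eq)
        nonNeg : ∀ e → 0ℚ ℚ.≤ term z (summand e)
        nonNeg e with e Subₚ.∈? X
        ... | yes e∈X = ℚₚ.≤-trans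
          (0≤*0≤ (0≤weight e) (≤⇒0≤ (ℚₚ.<⇒≤ (above e e∈X))))
          (ℚₚ.≤-reflexive (certificate (weight e) (threshold (rank e)) (z (c e))
            (proj₂ (proj₂ (reciprocal (rank e))))))
        ... | no _ = ℚₚ.≤-reflexive (sym (term-zero z (c e)))

      point-negative : ∀ Y → 𝒞 Y → eval (map summand (allFin n)) (point Y) ℚ.< 0ℚ
      point-negative Y 𝒞Y
        with Finₚ.any? (λ e → (e Subₚ.∈? X) ×-dec ¬? (e Subₚ.∈? Y))
      ... | no none = contradiction
        (λ {e} e∈X → decidable-stable (e Subₚ.∈? Y) λ e∉Y → none (e , e∈X , e∉Y))
        (unbounded Y 𝒞Y)
      ... | yes (e₀ , e₀∈X , e₀∉Y) = subst (eval (map summand (allFin n)) (point Y) ℚ.<_)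
        (ℚₚ.+-inverseʳ κ)
        (eval<ones summand (point Y) ≤1 ≤-κ (List.∈-allFin e₀))
        where
        open +-*-Solver
        ≤1 : ∀ e → term (point Y) (summand e) ℚ.≤ 1ℚ
        ≤1 e with e Subₚ.∈? X
        ... | yes _ = 0≤+⇒≤ (0≤*0≤ (0≤weight e) (ℚₚ.<⇒≤ (level>0 (height Y (c e)))))
          (certificate (weight e) (level (height Y (c e))))
          where
          certificate : ∀ w u → w ℚ.* (ℚ.- u) ℚ.+ 1ℚ ℚ.+ w ℚ.* u ≡ 1ℚ
          certificate = solve 2 (λ w u → w :* (:- u) :+ con 1ℚ :+ w :* u := con 1ℚ) refl
        ... | no _ = ℚₚ.≤-trans (ℚₚ.≤-reflexive (term-zero (point Y) (c e)))
          (ℚₚ.<⇒≤ (ℚₚ.positive⁻¹ 1ℚ))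
        ≤-κ : term (point Y) (summand e₀) ℚ.≤ ℚ.- κ
        ≤-κ with e₀ Subₚ.∈? X
        ... | no e₀∉X = contradiction e₀∈X e₀∉X
        -- With ρ the level at the rank of `e₀`, the coordinate is at most - ρ. The weight is 1 / (δ
        -- ρ²), so weight times ρ² is `D` = `κ` + 2; since ρ² ≤ ρ, the summand is at most 1 - (`κ` +
        -- 2), and the certificate's 1 is the remaining slack.
        ... | yes _ = 0≤+⇒≤
          (0≤+0≤ (0≤+0≤ (ℚₚ.<⇒≤ (ℚₚ.positive⁻¹ 1ℚ))
            (0≤*0≤ (0≤weight e₀) (≤⇒0≤ (level-antitone (height-∉ 𝒞Y e₀∉Y)))))
            (0≤*0≤ (0≤weight e₀) (≤⇒0≤ (level²≤level (rank e₀)))))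
          (certificate (weight e₀) (level (height Y (c e₀))) (level (rank e₀)) κ δ
            (proj₂ (proj₂ scale)) (subst (λ τ → τ ℚ.* weight e₀ ≡ 1ℚ) (threshold-def (rank e₀))
              (proj₂ (proj₂ (reciprocal (rank e₀))))))
          where
          weight-level² : ∀ w ρ κ δ → (κ ℚ.+ (1ℚ ℚ.+ 1ℚ)) ℚ.* δ ≡ 1ℚ →
            (δ ℚ.* (ρ ℚ.* ρ)) ℚ.* w ≡ 1ℚ → w ℚ.* (ρ ℚ.* ρ) ≡ κ ℚ.+ (1ℚ ℚ.+ 1ℚ)
          weight-level² w ρ κ δ Dδ τw = trans (sym (ℚₚ.*-identityʳ _)) (trans
            (cong (w ℚ.* (ρ ℚ.* ρ) ℚ.*_) (sym Dδ)) (trans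
            (solve 4 (λ w ρ D δ → w :* (ρ :* ρ) :* (D :* δ) := D :* ((δ :* (ρ :* ρ)) :* w))
              refl w ρ (κ ℚ.+ (1ℚ ℚ.+ 1ℚ)) δ) (trans
            (cong ((κ ℚ.+ (1ℚ ℚ.+ 1ℚ)) ℚ.*_) τw) (ℚₚ.*-identityʳ _))))
          certificate : ∀ w u ρ κ δ → (κ ℚ.+ (1ℚ ℚ.+ 1ℚ)) ℚ.* δ ≡ 1ℚ →
            (δ ℚ.* (ρ ℚ.* ρ)) ℚ.* w ≡ 1ℚ →
            w ℚ.* (ℚ.- u) ℚ.+ 1ℚ ℚ.+ (1ℚ ℚ.+ w ℚ.* (u ℚ.- ρ) ℚ.+ w ℚ.* (ρ ℚ.- ρ ℚ.* ρ)) ≡ ℚ.- κ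
          certificate w u ρ κ δ Dδ τw = trans
            (solve 3 (λ w u ρ →
              w :* (:- u) :+ con 1ℚ :+ (con 1ℚ :+ w :* (u :- ρ) :+ w :* (ρ :- ρ :* ρ)) :=
              con 1ℚ :+ con 1ℚ :- w :* (ρ :* ρ)) refl w u ρ)
            (trans (cong (λ h → 1ℚ ℚ.+ 1ℚ ℚ.- h) (weight-level² w ρ κ δ Dδ τw))
              (solve 1 (λ κ → con 1ℚ :+ con 1ℚ :- (κ :+ (con 1ℚ :+ con 1ℚ)) := :- κ) refl κ))

    separator : Separator X
    separator = record
      { form = map summand (allFin n) ; cell-nonneg = cell-nonneg ; point-negative = point-negative }

  separate : ∀ X → 𝒞 X ⊎ Separator X
  separate X with Finₚ.any? (λ e → (e Subₚ.∈? X) ×-dec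
                    Finₚ.any? (λ f → (f ≼? e) ×-dec ¬? (f Subₚ.∈? X)))
  ... | yes (e , e∈X , f , f≼e , f∉X) = inj₂ (OrderSeparator.separator f≼e e∈X f∉X)
  ... | no closed with Subₚ.anySubset? (λ Z → 𝒞? Z ×-dec (X Subₚ.⊆? Z))
  ...   | no unbounded = inj₂ (BoundSeparator.separator λ Z 𝒞Z X⊆Z → unbounded (Z , 𝒞Z , X⊆Z))
  ...   | yes (Z , 𝒞Z , X⊆Z) = inj₁ (bounded-downset-member
            (λ {e} {f} f≼e e∈X → decidable-stable (f Subₚ.∈? X) λ f∉X →
              closed (e , e∈X , f , f≼e , f∉X))
            𝒞Z X⊆Z)

  chainRealization : Realization 𝒞 m
  chainRealization = realization separate point-inCell

corollary40 : ∀ (n : ℕ) (𝒞 : SetSystem n) → Decidable 𝒞 →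
    IsBouquetOfDownsetAlignments 𝒞 ⊎ IsMedian 𝒞 →
    Covers 𝒞 →
    ∀ (ℓ d : ℕ) → HasMaximalMembers 𝒞 ℓ → IsVCDimension 𝒞 d →
    Realizable 𝒞 × EuclideanDimension≤ 𝒞 (n ⊓ (ℓ * d))
corollary40 n 𝒞 𝒞? bouquet⊎median covers ℓ d maximal vc =
  (N , R) , (N , ℕₚ.≤-refl , R) , λ _ (_ , least) → least N R
  where
  N : ℕ
  N = n ⊓ (ℓ * d)
  sys : IsDownsetSystem 𝒞
  sys = [ bouquet⇒downsetSystem 𝒞? covers , median⇒downsetSystem ]′ bouquet⊎median
  R : Realization 𝒞 N
  R = let c , c-chain = DownsetSystem.chain-colouring 𝒞? sys covers maximal vc
      in ChainRealization.chainRealization 𝒞? sys covers c c-chain
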